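{- For every nonnegative integer $\ell$, every nonnegative integer $n$ and every complex number $x$, $$\sum_{k=0}^n (q^{ -3n};q^3)_k \left[\begin{matrix} x,\ q^{ -\ell}/x\\ q,\ -1,\ q^{1/2-\ell},\ -q^{1/2},\ q^{ -3n}\end{matrix}\middle| q\right]_k q^k = \left[\begin{matrix} qx,\ q^{1/2}x\\ qx^2,\ q^{1/2}\end{matrix}\middle|q\right]_\ell \sum_{i=0}^{\ell} q^{(\ell+\frac12)i}\,\frac{1+xq^{i}}{2(1+x)}\left[\begin{matrix} q^{ -\ell},\ x^2\\ q,\ x^2q^{\ell+1}\end{matrix}\middle|q\right]_i\left\{\left[\begin{matrix} q^{1+i}x,\ q^{2-i}/x\\ q,\ q^2\end{matrix}\middle|q^3\right]_n+\left[\begin{matrix} q^{2+i}x,\ q^{1-i}/x\\ q,\ q^2\end{matrix}\middle|q^3\right]_n\right\}.$$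
   Context: $q$ is a complex number with a fixed square root $q^{1/2}$, and $q^{r/2}$ means $(q^{1/2})^r$. For a complex number $a$, a base $p$ and a nonnegative integer $m$, $(a;p)_m=\prod_{j=0}^{m-1}(1-ap^j)$ with $(a;p)_0=1$. The bracket notation means $\left[\begin{matrix} a_1,\dots,a_r\\ b_1,\dots,b_s\end{matrix}\middle|p\right]_m=\frac{(a_1;p)_m\cdots(a_r;p)_m}{(b_1;p)_m\cdots(b_s;p)_m}$ (used with $p=q$ and $p=q^3$). The identity is understood for values of the parameters for which no denominator vanishes. -}

module Defs where

open import Level using (Level; _⊔_) renaming (suc to lsuc)
open import Data.Nat using (ℕ; zero; suc)
open import Data.Integer using (ℤ; +_; -[1+_])
open import Data.Fin using (Fin; toℕ)
open import Relation.Nullary using (¬_)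
open import Algebra.Bundles using (CommutativeRing)

record Field (c ℓ : Level) : Set (lsuc (c ⊔ ℓ)) where
  field
    commutativeRing : CommutativeRing c ℓ
  open CommutativeRing commutativeRing public
  field
    inv       : (a : Carrier) → ¬ (a ≈ 0#) → Carrier
    inverseʳ  : (a : Carrier) (p : ¬ (a ≈ 0#)) → (a * inv a p) ≈ 1#
    nontrivial : ¬ (1# ≈ 0#)

  fromℕ : ℕ → Carrier
  fromℕ zero    = 0#
  fromℕ (suc n) = 1# + fromℕ n

  infixr 8 _^_
  _^_ : Carrier → ℕ → Carrier
  a ^ zero  = 1#
  a ^ suc m = a * (a ^ m)

  div : (a b : Carrier) → ¬ (b ≈ 0#) → Carrier
  div a b p = a * inv b p

  sumFin : (m : ℕ) → (Fin m → Carrier) → Carrier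
  sumFin zero    f = 0#
  sumFin (suc m) f = f Fin.zero + sumFin m (λ k → f (Fin.suc k))

  poch : Carrier → Carrier → ℕ → Carrier
  poch a p zero    = 1#
  poch a p (suc m) = poch a p m * (1# - a * (p ^ m))

  -- Given a fixed nonzero s (playing the role of q^{1/2}),
  -- hpow s p z = s^z = q^{z/2} for an integer z.
  hpow : (s : Carrier) → ¬ (s ≈ 0#) → ℤ → Carrier
  hpow s p (+ m)     = s ^ m
  hpow s p -[1+ m ]  = inv s p ^ suc m

CharZero : ∀ {c ℓ} → Field c ℓ → Set ℓ
CharZero F = (n : ℕ) → ¬ (fromℕ (suc n) ≈ 0#)
  where open Field F

module Submission where

-- Write (a)_k for (a;q)_k. The case l = 0 with its denominators cleared is a polynomial identity: the factor
-- (qx;q³)_n (q²/x;q³)_n is expanded in the basis (x)_k (q/x)_k, and multiplying by the next factor gives a recurrence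
-- for the coefficients, solved by q^(k²) times a Gaussian binomial times (q;q³)_(n-k) (q²;q³)_(n-k). Adding the
-- expansion at 1/x turns the basis into (1 + q^k) (x)_k (1/x)_k.
--
-- For general l, (x)_k (q^(-l)/x)_k / (q^(1/2-l))_k is a combination of the products (q^i x)_k (q^(-i)/x)_k with
-- 0 ≤ i ≤ l. This follows by induction on l from a three-term relation between its values at (l+1, x), (l, x) and
-- (l, qx). Summing over k and applying the case l = 0 at q^i x to each i gives the theorem.
--
-- Denominators are kept out of the case l = 0 because the hypotheses allow (q^(1/2))_n to vanish.

-- The basis (x)_k (q/x)_k is dictated by the cubic factor: for xy = 1, both (1 - q^(3n+1) x)(1 -
-- q^(3n+2) y) and (1 - q^k x)(1 - q^(k+1) y) are combinations of 1 and x + qy, so one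
-- multiplication reaches only the indices k and k + 1. The braces in the theorem are one such
-- product plus its image under x -> 1/x, which is why symmetrising suffices. On the left-hand side
-- only (q^(-l)/x)_k / (q^(1/2-l))_k depends on l, so a connection formula for this quotient is all
-- that general l requires beyond l = 0. The shift x -> qx in its recurrence acts on the products
-- (q^i x)_k (q^(-i)/x)_k as i -> i + 1. Both recurrences therefore have the shape of Pascal's rule,
-- passing from i + j = n to i + j = n + 1, and both are summed by `anti-suc`. The inverses of q and
-- x enter as elements `r` and `y` with `q * r ≈ 1#` and `x * y ≈ 1#`, so that most steps are
-- polynomial identities modulo such relations.

open import Defs
open import Algebra.Bundles using (CommutativeRing)
import Algebra.Solver.Ring
open import Algebra.Solver.Ring.AlmostCommutativeRing using (fromCommutativeRing; _-Raw-AlmostCommutative⟶_)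
open import Data.Fin using (Fin; toℕ)
import Data.Fin.Properties as Fin
open import Data.Integer as Z using (ℤ; +_; -[1+_])
import Data.Integer.Properties as Z
open import Data.Maybe.Base using (Maybe; map)
open import Data.Nat as N using (ℕ; zero; suc)
import Data.Nat.Properties as N
open import Data.Product using (Σ; _,_; _×_)
open import Relation.Binary.PropositionalEquality as ≡ using (_≡_)
open import Relation.Nullary using (¬_)
open import Relation.Nullary.Decidable using (dec⇒maybe)

-- A ring solver with integer coefficients.

-- The coefficients are integers because equality of ring elements is not decidable, so that with coefficients in
-- the ring itself the solver would not recognise cancellations.
module IntegerSolver {c ℓ} (R : CommutativeRing c ℓ) where
  open CommutativeRing R
  open import Algebra.Properties.Ring ring
  open import Algebra.Properties.Semiring.Mult.TCOptimised semiring renaming (_×_ to infixl 8 _·_)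
  open import Relation.Binary.Reasoning.Setoid setoid

  ⟦_⟧ℤ : ℤ → Carrier
  ⟦ + n      ⟧ℤ = n · 1#
  ⟦ -[1+ n ] ⟧ℤ = - (suc n · 1#)

  -‿homo : ∀ i → ⟦ Z.- i ⟧ℤ ≈ - ⟦ i ⟧ℤ
  -‿homo (+ zero)  = sym -0#≈0#
  -‿homo (+ suc n) = refl
  -‿homo -[1+ n ]  = sym (-‿involutive _)

  ⊖-homo : ∀ m n → ⟦ m Z.⊖ n ⟧ℤ ≈ m · 1# - n · 1#
  ⊖-homo m zero = sym (trans (+-congˡ -0#≈0#) (+-identityʳ _))
  ⊖-homo zero (suc n) = sym (+-identityˡ _)
  ⊖-homo (suc m) (suc n) = begin
    ⟦ suc m Z.⊖ suc n ⟧ℤ                ≡⟨ ≡.cong ⟦_⟧ℤ (Z.[1+m]⊖[1+n]≡m⊖n m n) ⟩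
    ⟦ m Z.⊖ n ⟧ℤ                        ≈⟨ ⊖-homo m n ⟩
    m · 1# - n · 1#                     ≈⟨ +-congˡ (+-identityˡ _) ⟨
    m · 1# + (0# - n · 1#)              ≈⟨ +-congˡ (+-congʳ (-‿inverseʳ 1#)) ⟨
    m · 1# + (1# - 1# - n · 1#)         ≈⟨ +-congˡ (+-assoc _ _ _) ⟩
    m · 1# + (1# + (- 1# - n · 1#))     ≈⟨ +-assoc _ _ _ ⟨
    m · 1# + 1# + (- 1# - n · 1#)       ≈⟨ +-cong (+-comm _ _) (-‿+-comm _ _) ⟩
    1# + m · 1# - (1# + n · 1#)         ≈⟨ +-cong (1+× m 1#) (-‿cong (1+× n 1#)) ⟨
    suc m · 1# - suc n · 1#             ∎

  +-homo : ∀ i j → ⟦ i Z.+ j ⟧ℤ ≈ ⟦ i ⟧ℤ + ⟦ j ⟧ℤ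
  +-homo (+ m) (+ n) = ×-homo-+ 1# m n
  +-homo (+ m) -[1+ n ] = ⊖-homo m (suc n)
  +-homo -[1+ m ] (+ n) = trans (⊖-homo n (suc m)) (+-comm _ _)
  +-homo -[1+ m ] -[1+ n ] = begin
    - (suc (suc (m N.+ n)) · 1#)        ≡⟨ ≡.cong (λ k → - (suc k · 1#)) (≡.sym (N.+-suc m n)) ⟩
    - ((suc m N.+ suc n) · 1#)          ≈⟨ -‿cong (×-homo-+ 1# (suc m) (suc n)) ⟩
    - (suc m · 1# + suc n · 1#)         ≈⟨ -‿+-comm _ _ ⟨
    - (suc m · 1#) - suc n · 1#         ∎

  +*-homo : ∀ m j → ⟦ + m Z.* j ⟧ℤ ≈ m · 1# * ⟦ j ⟧ℤ
  +*-homo m (+ n) = begin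
    ⟦ + m Z.* + n ⟧ℤ                    ≡⟨ ≡.cong ⟦_⟧ℤ (≡.sym (Z.pos-* m n)) ⟩
    (m N.* n) · 1#                      ≈⟨ ×1-homo-* m n ⟩
    m · 1# * (n · 1#)                   ∎
  +*-homo m -[1+ n ] = begin
    ⟦ + m Z.* -[1+ n ] ⟧ℤ               ≡⟨ ≡.cong ⟦_⟧ℤ (≡.sym (Z.neg-distribʳ-* (+ m) (+ suc n))) ⟩
    ⟦ Z.- (+ m Z.* + suc n) ⟧ℤ          ≈⟨ -‿homo (+ m Z.* + suc n) ⟩
    - ⟦ + m Z.* + suc n ⟧ℤ              ≈⟨ -‿cong (+*-homo m (+ suc n)) ⟩
    - (m · 1# * (suc n · 1#))           ≈⟨ -‿distribʳ-* _ _ ⟩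
    m · 1# * - (suc n · 1#)             ∎

  *-homo : ∀ i j → ⟦ i Z.* j ⟧ℤ ≈ ⟦ i ⟧ℤ * ⟦ j ⟧ℤ
  *-homo (+ m) j = +*-homo m j
  *-homo -[1+ m ] j = begin
    ⟦ -[1+ m ] Z.* j ⟧ℤ                 ≡⟨ ≡.cong ⟦_⟧ℤ (≡.sym (Z.neg-distribˡ-* (+ suc m) j)) ⟩
    ⟦ Z.- (+ suc m Z.* j) ⟧ℤ            ≈⟨ -‿homo (+ suc m Z.* j) ⟩
    - ⟦ + suc m Z.* j ⟧ℤ                ≈⟨ -‿cong (+*-homo (suc m) j) ⟩
    - (suc m · 1# * ⟦ j ⟧ℤ)             ≈⟨ -‿distribˡ-* _ _ ⟩
    - (suc m · 1#) * ⟦ j ⟧ℤ             ∎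

  morphism : Z.+-*-rawRing -Raw-AlmostCommutative⟶ fromCommutativeRing R
  morphism = record
    { ⟦_⟧    = ⟦_⟧ℤ
    ; +-homo = +-homo
    ; *-homo = *-homo
    ; -‿homo = -‿homo
    ; 0-homo = refl
    ; 1-homo = refl
    }

  _coeff≟_ : ∀ i j → Maybe (⟦ i ⟧ℤ ≈ ⟦ j ⟧ℤ)
  i coeff≟ j = map (λ i≡j → reflexive (≡.cong ⟦_⟧ℤ i≡j)) (dec⇒maybe (i Z.≟ j))

  open Algebra.Solver.Ring Z.+-*-rawRing (fromCommutativeRing R) morphism _coeff≟_ public

-- Field arithmetic, Pochhammer symbols and sums over antidiagonals.

module FieldLemmas {c ℓ} (F : Field c ℓ) where
  open Field F hiding (zero)
  open IntegerSolver commutativeRing public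
    using (solve; _:=_; con; _:+_; _:*_; _:-_; :-_; _:^_; Polynomial)
  open import Relation.Binary.Reasoning.Setoid setoid

  :1 : ∀ {n} → Polynomial n
  :1 = con (+ 1)

  -- The solver proves only identities valid in every commutative ring. To use a relation `u ≈ v`,
  -- the multiple `d * (u - v)` by which the two sides differ is supplied and the solver checks the
  -- rest; nested uses reduce by several relations, with the `d` as cofactors.
  modulo : ∀ d {u v a b} → u ≈ v → a ≈ b + d * (u - v) → a ≈ b
  modulo d {u} {v} {a} {b} u≈v eq = begin
    a                ≈⟨ eq ⟩
    b + d * (u - v)  ≈⟨ +-congˡ (*-congˡ (+-congʳ u≈v)) ⟩
    b + d * (v - v)  ≈⟨ solve 3 (λ b d v → b :+ d :* (v :- v) := b) refl b d v ⟩
    b                ∎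

  *-cancelˡ : ∀ d {a b} → ¬ (d ≈ 0#) → d * a ≈ d * b → a ≈ b
  *-cancelˡ d {a} {b} d≉0 eq = begin
    a                     ≈⟨ lemma a ⟩
    inv d d≉0 * (d * a)   ≈⟨ *-congˡ eq ⟩
    inv d d≉0 * (d * b)   ≈⟨ lemma b ⟨
    b                     ∎
    where
    lemma : ∀ a → a ≈ inv d d≉0 * (d * a)
    lemma a = begin
      a                    ≈⟨ *-identityˡ a ⟨
      1# * a               ≈⟨ *-congʳ (inverseʳ d d≉0) ⟨
      d * inv d d≉0 * a    ≈⟨ solve 3 (λ d i a → d :* i :* a := i :* (d :* a)) refl d (inv d d≉0) a ⟩
      inv d d≉0 * (d * a)  ∎

  *-nonzero : ∀ {a b} → ¬ (a ≈ 0#) → ¬ (b ≈ 0#) → ¬ (a * b ≈ 0#)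
  *-nonzero {a} a≉0 b≉0 ab≈0 = b≉0 (*-cancelˡ a a≉0 (trans ab≈0 (sym (zeroʳ a))))

  nonzero-*ˡ : ∀ {a b} → ¬ (a * b ≈ 0#) → ¬ (a ≈ 0#)
  nonzero-*ˡ ab≉0 a≈0 = ab≉0 (trans (*-congʳ a≈0) (zeroˡ _))

  nonzero-*ʳ : ∀ {a b} → ¬ (a * b ≈ 0#) → ¬ (b ≈ 0#)
  nonzero-*ʳ ab≉0 b≈0 = ab≉0 (trans (*-congˡ b≈0) (zeroʳ _))

  div-* : ∀ a b b≉0 → div a b b≉0 * b ≈ a
  div-* a b b≉0 = modulo a (inverseʳ b b≉0)
    (solve 3 (λ a b i → a :* i :* b := a :+ a :* (b :* i :- :1)) refl a b (inv b b≉0))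

  -- A scaled fraction can thus be evaluated without computing with inverses: only the
  -- cross-multiplied equation has to be shown.
  div-intro : ∀ d a b b≉0 e → d * a ≈ b * e → d * div a b b≉0 ≈ e
  div-intro d a b b≉0 e eq = *-cancelˡ b b≉0 (begin
    b * (d * div a b b≉0)  ≈⟨ solve 3 (λ b d i → b :* (d :* i) := d :* (i :* b)) refl b d (div a b b≉0) ⟩
    d * (div a b b≉0 * b)  ≈⟨ *-congˡ (div-* a b b≉0) ⟩
    d * a                  ≈⟨ eq ⟩
    b * e                  ∎)

  ^-cong : ∀ {a b} n → a ≈ b → a ^ n ≈ b ^ n
  ^-cong zero a≈b = refl
  ^-cong (suc n) a≈b = *-cong a≈b (^-cong n a≈b)

  ^-homo-+ : ∀ a m n → a ^ (m N.+ n) ≈ a ^ m * a ^ n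
  ^-homo-+ a zero n = sym (*-identityˡ _)
  ^-homo-+ a (suc m) n = trans (*-congˡ (^-homo-+ a m n)) (sym (*-assoc _ _ _))

  ^-distrib-* : ∀ a b n → (a * b) ^ n ≈ a ^ n * b ^ n
  ^-distrib-* a b zero = sym (*-identityˡ _)
  ^-distrib-* a b (suc n) = trans (*-congˡ (^-distrib-* a b n))
    (solve 4 (λ a b x y → a :* b :* (x :* y) := a :* x :* (b :* y)) refl a b (a ^ n) (b ^ n))

  1^ : ∀ n → 1# ^ n ≈ 1#
  1^ zero = refl
  1^ (suc n) = trans (*-identityˡ _) (1^ n)

  ^-comm : ∀ a m n → (a ^ m) ^ n ≈ (a ^ n) ^ m
  ^-comm a zero n = 1^ n
  ^-comm a (suc m) n = trans (^-distrib-* a (a ^ m) n) (*-congˡ (^-comm a m n))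

  ^-assoc : ∀ a m n → (a ^ m) ^ n ≈ a ^ (n N.* m)
  ^-assoc a m zero = refl
  ^-assoc a m (suc n) = trans (*-congˡ (^-assoc a m n)) (sym (^-homo-+ a m (n N.* m)))

  ^-square : ∀ a k → a ^ (suc k N.* suc k) ≈ a ^ (k N.* k) * (a * (a ^ k * a ^ k))
  ^-square a k = begin
    a * a ^ (k N.+ k N.* suc k)          ≡⟨ ≡.cong (λ e → a * a ^ (k N.+ e)) (N.*-suc k k) ⟩
    a * a ^ (k N.+ (k N.+ k N.* k))      ≈⟨ *-congˡ (trans (^-homo-+ a k _) (*-congˡ (^-homo-+ a k _))) ⟩
    a * (a ^ k * (a ^ k * a ^ (k N.* k)))
      ≈⟨ solve 3 (λ a b d → a :* (b :* (b :* d)) := d :* (a :* (b :* b))) refl a (a ^ k) (a ^ (k N.* k)) ⟩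
    a ^ (k N.* k) * (a * (a ^ k * a ^ k)) ∎

  ^-inverse : ∀ {a b} n → a * b ≈ 1# → a ^ n * b ^ n ≈ 1#
  ^-inverse n ab≈1 = trans (sym (^-distrib-* _ _ n)) (trans (^-cong n ab≈1) (1^ n))

  poch-cong : ∀ {a b} p n → a ≈ b → poch a p n ≈ poch b p n
  poch-cong p zero a≈b = refl
  poch-cong p (suc n) a≈b = *-cong (poch-cong p n a≈b) (+-congˡ (-‿cong (*-congʳ a≈b)))

  poch-head : ∀ a p n → poch a p (suc n) ≈ (1# - a) * poch (a * p) p n
  poch-head a p zero = solve 1 (λ a → :1 :* (:1 :- a :* :1) := (:1 :- a) :* :1) refl a
  poch-head a p (suc n) = begin
    poch a p (suc n) * (1# - a * (p * p ^ n))                   ≈⟨ *-congʳ (poch-head a p n) ⟩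
    (1# - a) * poch (a * p) p n * (1# - a * (p * p ^ n))
      ≈⟨ solve 4 (λ a p h x → (:1 :- a) :* h :* (:1 :- a :* (p :* x)) := (:1 :- a) :* (h :* (:1 :- a :* p :* x))) refl a p _ _ ⟩
    (1# - a) * (poch (a * p) p n * (1# - a * p * p ^ n))        ∎

  poch-+ : ∀ a p m n → poch a p (m N.+ n) ≈ poch a p m * poch (a * p ^ m) p n
  poch-+ a p zero n = trans (poch-cong p n (sym (*-identityʳ a))) (sym (*-identityˡ _))
  poch-+ a p (suc m) n = begin
    poch a p (suc (m N.+ n))                                         ≈⟨ poch-head a p (m N.+ n) ⟩
    (1# - a) * poch (a * p) p (m N.+ n)                              ≈⟨ *-congˡ (poch-+ (a * p) p m n) ⟩
    (1# - a) * (poch (a * p) p m * poch (a * p * p ^ m) p n)         ≈⟨ *-assoc _ _ _ ⟨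
    (1# - a) * poch (a * p) p m * poch (a * p * p ^ m) p n
      ≈⟨ *-cong (poch-head a p m) (poch-cong p n (sym (*-assoc a p (p ^ m)))) ⟨
    poch a p (suc m) * poch (a * (p * p ^ m)) p n                    ∎

  -- The cofactor is left unspecified because the only use is to conclude that the product vanishes
  -- along with one of its factors.
  poch-factor : ∀ a p m n → Σ Carrier λ d → poch a p (suc (m N.+ n)) ≈ d * (1# - a * p ^ m)
  poch-factor a p m zero = poch a p m , lemma
    where
    lemma : poch a p (suc (m N.+ zero)) ≈ poch a p m * (1# - a * p ^ m)
    lemma rewrite N.+-identityʳ m = refl
  poch-factor a p m (suc n) with poch-factor a p m n
  ... | d , eq = d * (1# - a * p ^ suc (m N.+ n)) , lemma
    where
    lemma : poch a p (suc (m N.+ suc n)) ≈ d * (1# - a * p ^ suc (m N.+ n)) * (1# - a * p ^ m)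
    lemma rewrite N.+-suc m n = trans (*-congʳ eq)
      (solve 3 (λ d x y → d :* x :* y := d :* y :* x) refl d _ _)

  -- Summands take both `k` and `n - k` as arguments, so that recurrences for them can be stated
  -- with constructors instead of truncated subtraction.
  anti : ℕ → (ℕ → ℕ → Carrier) → Carrier
  anti n h = sumFin (suc n) (λ k → h (toℕ k) (n N.∸ toℕ k))

  sumFin-cong : ∀ n {f g : Fin n → Carrier} → (∀ k → f k ≈ g k) → sumFin n f ≈ sumFin n g
  sumFin-cong zero eq = refl
  sumFin-cong (suc n) eq = +-cong (eq Fin.zero) (sumFin-cong n (λ k → eq (Fin.suc k)))

  *-distribˡ-sumFin : ∀ n d (f : Fin n → Carrier) → d * sumFin n f ≈ sumFin n (λ k → d * f k)
  *-distribˡ-sumFin zero d f = zeroʳ d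
  *-distribˡ-sumFin (suc n) d f = trans (distribˡ _ _ _) (+-congˡ (*-distribˡ-sumFin n d _))

  sumFin-+ : ∀ n (f g : Fin n → Carrier) → sumFin n (λ k → f k + g k) ≈ sumFin n f + sumFin n g
  sumFin-+ zero f g = sym (+-identityˡ _)
  sumFin-+ (suc n) f g = trans (+-congˡ (sumFin-+ n _ _))
    (solve 4 (λ a b x y → a :+ b :+ (x :+ y) := a :+ x :+ (b :+ y)) refl _ _ _ _)

  sumFin-0 : ∀ n → sumFin n (λ _ → 0#) ≈ 0#
  sumFin-0 zero = refl
  sumFin-0 (suc n) = trans (+-identityˡ _) (sumFin-0 n)

  sumFin-swap : ∀ m n (f : Fin m → Fin n → Carrier) →
    sumFin m (λ i → sumFin n (f i)) ≈ sumFin n (λ j → sumFin m (λ i → f i j))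
  sumFin-swap zero n f = sym (sumFin-0 n)
  sumFin-swap (suc m) n f = trans (+-congˡ (sumFin-swap m n _)) (sym (sumFin-+ n _ _))

  complement : ∀ n (k : Fin (suc n)) → toℕ k N.+ (n N.∸ toℕ k) ≡ n
  complement n k = N.m+[n∸m]≡n (N.s≤s⁻¹ (Fin.toℕ<n k))

  anti-cong : ∀ n {g h : ℕ → ℕ → Carrier} → (∀ i j → i N.+ j ≡ n → g i j ≈ h i j) → anti n g ≈ anti n h
  anti-cong n eq = sumFin-cong (suc n) (λ k → eq (toℕ k) (n N.∸ toℕ k) (complement n k))

  anti-* : ∀ n d h → d * anti n h ≈ anti n (λ i j → d * h i j)
  anti-* n d h = *-distribˡ-sumFin (suc n) d (λ k → h (toℕ k) (n N.∸ toℕ k))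

  anti-+ : ∀ n g h → anti n (λ i j → g i j + h i j) ≈ anti n g + anti n h
  anti-+ n g h = sumFin-+ (suc n) (λ k → g (toℕ k) (n N.∸ toℕ k)) (λ k → h (toℕ k) (n N.∸ toℕ k))

  -- Splitting every `t (suc i) j` with i + j = n produces each `v i j` and each `u i j` on the
  -- antidiagonal except `u 0 n`, which is therefore added on the left. The induction shifts the
  -- first index of all three arrays.
  anti-pascal : ∀ n (t u v : ℕ → ℕ → Carrier) →
    (∀ i → t (suc i) 0 ≈ v i 0) →
    (∀ i j → t (suc i) (suc j) ≈ u (suc i) j + v i (suc j)) →
    anti n (λ i j → t (suc i) j) + u 0 n ≈ anti n u + anti n v
  anti-pascal zero t u v t≈v t≈u+v = trans (+-congʳ (+-congʳ (t≈v 0)))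
    (solve 2 (λ u v → v :+ con (+ 0) :+ u := u :+ con (+ 0) :+ (v :+ con (+ 0))) refl _ _)
  anti-pascal (suc n) t u v t≈v t≈u+v = begin
    t 1 (suc n) + anti n (λ i j → t (suc (suc i)) j) + u 0 (suc n)
      ≈⟨ +-congʳ (+-congʳ (t≈u+v 0 n)) ⟩
    u 1 n + v 0 (suc n) + anti n (λ i j → t (suc (suc i)) j) + u 0 (suc n)
      ≈⟨ solve 4 (λ a b e f → a :+ b :+ e :+ f := f :+ b :+ (e :+ a)) refl _ _ _ _ ⟩
    u 0 (suc n) + v 0 (suc n) + (anti n (λ i j → t (suc (suc i)) j) + u 1 n)
      ≈⟨ +-congˡ (anti-pascal n (λ i → t (suc i)) (λ i → u (suc i)) (λ i → v (suc i)) (λ i → t≈v (suc i)) (λ i → t≈u+v (suc i))) ⟩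
    u 0 (suc n) + v 0 (suc n) + (anti n (λ i j → u (suc i) j) + anti n (λ i j → v (suc i) j))
      ≈⟨ solve 4 (λ a b e f → a :+ b :+ (e :+ f) := a :+ e :+ (b :+ f)) refl _ _ _ _ ⟩
    u 0 (suc n) + anti n (λ i j → u (suc i) j) + (v 0 (suc n) + anti n (λ i j → v (suc i) j)) ∎

  -- A Pascal-type recurrence in summed form: an entry receives `u` from the neighbour with smaller
  -- second index and `v` from the one with smaller first index; a border entry has only one of
  -- these neighbours.
  anti-suc : ∀ n (t u v : ℕ → ℕ → Carrier) →
    (∀ j → t 0 (suc j) ≈ u 0 j) →
    (∀ i → t (suc i) 0 ≈ v i 0) →
    (∀ i j → t (suc i) (suc j) ≈ u (suc i) j + v i (suc j)) →
    anti (suc n) t ≈ anti n u + anti n v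
  anti-suc n t u v t≈u t≈v t≈u+v =
    trans (+-congʳ (t≈u n)) (trans (+-comm _ _) (anti-pascal n t u v t≈v t≈u+v))

-- Defined by recursion so that `poch`, `gauss` and powers at `double (suc k)` or `triple (suc m)`
-- unfold by computation.
double triple : ℕ → ℕ
double zero    = zero
double (suc n) = suc (suc (double n))
triple zero    = zero
triple (suc n) = suc (suc (suc (triple n)))

triple-double : ∀ n → triple n ≡ double n N.+ n
triple-double zero = ≡.refl
triple-double (suc n) = ≡.cong (λ e → suc (suc e)) (≡.trans (≡.cong suc (triple-double n)) (≡.sym (N.+-suc (double n) n)))

-- Gaussian binomials and the coefficients of the cubic expansion.

module QLemmas {c ℓ} (F : Field c ℓ) (q : Field.Carrier F) where
  open Field F hiding (zero)
  open FieldLemmas F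
  open import Relation.Binary.Reasoning.Setoid setoid

  q3 : Carrier
  q3 = q ^ 3

  ^-double : ∀ n → q ^ double n ≈ q ^ n * q ^ n
  ^-double zero = sym (*-identityˡ _)
  ^-double (suc n) = trans (*-congˡ (*-congˡ (^-double n)))
    (solve 2 (λ q x → q :* (q :* (x :* x)) := q :* x :* (q :* x)) refl q _)

  ^-triple : ∀ n → q ^ triple n ≈ q3 ^ n
  ^-triple zero = refl
  ^-triple (suc n) = trans (*-congˡ (*-congˡ (*-congˡ (^-triple n))))
    (solve 2 (λ q x → q :* (q :* (q :* x)) := q :^ 3 :* x) refl q _)

  q3^ : ∀ n → q3 ^ n ≈ (q ^ n) ^ 3
  q3^ n = ^-comm q 3 n

  -- gauss a b is the Gaussian binomial coefficient of a + b over a.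
  gauss : ℕ → ℕ → Carrier
  gauss zero    b       = 1#
  gauss (suc a) zero    = 1#
  gauss (suc a) (suc b) = gauss a (suc b) + q ^ suc a * gauss (suc a) b

  gauss-0 : ∀ a → gauss a 0 ≈ 1#
  gauss-0 zero = refl
  gauss-0 (suc a) = refl

  -- The two absorption rules are proved together: at (a, b) they combine into `gauss-cross`, which
  -- is what the Pascal step to (a, b + 1) in the first rule and to (a + 1, b) in the second
  -- requires.
  gauss-sucˡ : ∀ a b → gauss (suc a) b * (1# - q ^ suc a) ≈ gauss a b * (1# - q ^ suc (a N.+ b))
  gauss-sucʳ : ∀ a b → gauss a (suc b) * (1# - q ^ suc b) ≈ gauss a b * (1# - q ^ suc (a N.+ b))

  gauss-cross : ∀ a b → gauss (suc a) b * (1# - q ^ suc a) ≈ gauss a (suc b) * (1# - q ^ suc b)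
  gauss-cross a b = trans (gauss-sucˡ a b) (sym (gauss-sucʳ a b))

  gauss-sucˡ a zero = *-cong (sym (gauss-0 a)) (+-congˡ (-‿cong (reflexive (≡.cong (λ e → q ^ suc e) (≡.sym (N.+-identityʳ a))))))
  gauss-sucˡ a (suc b) = begin
    (gauss a (suc b) + q ^ suc a * gauss (suc a) b) * (1# - q ^ suc a)
      ≈⟨ modulo (q ^ suc a) (gauss-cross a b)
           (solve 4 (λ x y A B → (x :+ A :* y) :* (:1 :- A) := x :* (:1 :- A :* B) :+ A :* (y :* (:1 :- A) :- x :* (:1 :- B)))
             refl (gauss a (suc b)) (gauss (suc a) b) (q ^ suc a) (q ^ suc b)) ⟩
    gauss a (suc b) * (1# - q ^ suc a * q ^ suc b)
      ≈⟨ *-congˡ (+-congˡ (-‿cong (^-homo-+ q (suc a) (suc b)))) ⟨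
    gauss a (suc b) * (1# - q ^ suc (a N.+ suc b)) ∎
  gauss-sucʳ zero b = refl
  gauss-sucʳ (suc a) b = begin
    (gauss a (suc b) + q ^ suc a * gauss (suc a) b) * (1# - q ^ suc b)
      ≈⟨ modulo (- 1#) (gauss-cross a b)
           (solve 4 (λ x y A B → (x :+ A :* y) :* (:1 :- B) := y :* (:1 :- A :* B) :+ (:- :1) :* (y :* (:1 :- A) :- x :* (:1 :- B)))
             refl (gauss a (suc b)) (gauss (suc a) b) (q ^ suc a) (q ^ suc b)) ⟩
    gauss (suc a) b * (1# - q ^ suc a * q ^ suc b)
      ≈⟨ *-congˡ (+-congˡ (-‿cong (^-homo-+ q (suc a) (suc b)))) ⟨
    gauss (suc a) b * (1# - q ^ (suc a N.+ suc b))
      ≡⟨ ≡.cong (λ e → gauss (suc a) b * (1# - q ^ suc e)) (N.+-suc a b) ⟩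
    gauss (suc a) b * (1# - q ^ suc (suc a N.+ b)) ∎

  -- The mirror image of the defining recurrence; the two right-hand sides differ by exactly
  -- `gauss-cross`.
  gauss-pascal′ : ∀ a b → gauss (suc a) (suc b) ≈ q ^ suc b * gauss a (suc b) + gauss (suc a) b
  gauss-pascal′ a b = modulo (- 1#) (gauss-cross a b)
    (solve 4 (λ x y A B → x :+ A :* y := B :* x :+ y :+ (:- :1) :* (y :* (:1 :- A) :- x :* (:1 :- B)))
      refl (gauss a (suc b)) (gauss (suc a) b) (q ^ suc a) (q ^ suc b))

  -- The quotient formula for the Gaussian binomial in product form, valid also where `poch q q b`
  -- vanishes.
  gauss-pochʳ : ∀ a b → gauss a b * poch q q b ≈ poch (q ^ suc a) q b
  gauss-pochʳ a zero = trans (*-congʳ (gauss-0 a)) (*-identityˡ _)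
  gauss-pochʳ a (suc b) = begin
    gauss a (suc b) * (poch q q b * (1# - q ^ suc b))          ≈⟨ solve 3 (λ g p d → g :* (p :* d) := g :* d :* p) refl _ _ _ ⟩
    gauss a (suc b) * (1# - q ^ suc b) * poch q q b            ≈⟨ *-congʳ (gauss-sucʳ a b) ⟩
    gauss a b * (1# - q ^ suc (a N.+ b)) * poch q q b          ≈⟨ solve 3 (λ g d p → g :* d :* p := g :* p :* d) refl _ _ _ ⟩
    gauss a b * poch q q b * (1# - q ^ (suc a N.+ b))          ≈⟨ *-cong (gauss-pochʳ a b) (+-congˡ (-‿cong (^-homo-+ q (suc a) b))) ⟩
    poch (q ^ suc a) q b * (1# - q ^ suc a * q ^ b)            ∎

  gauss-pochˡ : ∀ a b → gauss a b * poch q q a ≈ poch (q ^ suc b) q a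
  gauss-pochˡ zero b = *-identityˡ _
  gauss-pochˡ (suc a) b = begin
    gauss (suc a) b * (poch q q a * (1# - q ^ suc a))          ≈⟨ solve 3 (λ g p d → g :* (p :* d) := g :* d :* p) refl _ _ _ ⟩
    gauss (suc a) b * (1# - q ^ suc a) * poch q q a            ≈⟨ *-congʳ (gauss-sucˡ a b) ⟩
    gauss a b * (1# - q ^ suc (a N.+ b)) * poch q q a          ≈⟨ solve 3 (λ g d p → g :* d :* p := g :* p :* d) refl _ _ _ ⟩
    gauss a b * poch q q a * (1# - q ^ suc (a N.+ b))          ≡⟨ ≡.cong (λ e → gauss a b * poch q q a * (1# - q ^ suc e)) (N.+-comm a b) ⟩
    gauss a b * poch q q a * (1# - q ^ (suc b N.+ a))          ≈⟨ *-cong (gauss-pochˡ a b) (+-congˡ (-‿cong (^-homo-+ q (suc b) a))) ⟩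
    poch (q ^ suc b) q a * (1# - q ^ suc b * q ^ a)            ∎

  -- This is (q;q)_(3m) with the factors 1 - q^(3j) left out.
  base : ℕ → Carrier
  base m = poch q q3 m * poch (q * q) q3 m

  base-suc : ∀ m → base (suc m) ≈ base m * ((1# - q * q ^ triple m) * (1# - q * (q * q ^ triple m)))
  base-suc m = trans (*-cong (*-congˡ (lemma q)) (*-congˡ (lemma (q * q))))
    (solve 4 (λ q a b x → a :* (:1 :- q :* x) :* (b :* (:1 :- q :* q :* x)) := a :* b :* ((:1 :- q :* x) :* (:1 :- q :* (q :* x))))
      refl q (poch q q3 m) (poch (q * q) q3 m) (q ^ triple m))
    where
    lemma : ∀ a → 1# - a * q3 ^ m ≈ 1# - a * q ^ triple m
    lemma a = +-congˡ (-‿cong (*-congˡ (sym (^-triple m))))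

  -- coeff k (n - k) is the coefficient of (x;q)_k (q/x;q)_k in (qx;q³)_n (q²/x;q³)_n.
  coeff : ℕ → ℕ → Carrier
  coeff k m = q ^ (k N.* k) * gauss (triple m) (double k) * base m

  -- With n = k + m and xy = 1, (1 - q^(3n+1) x)(1 - q^(3n+2) y) equals `cubicFactor₁ k m` plus
  -- `cubicFactor₂ k m` times (1 - q^k x)(1 - q^(k+1) y). Comparing the terms in x gives the second
  -- factor, and the constant that remains factorises as in the first.
  cubicFactor₁ cubicFactor₂ : ℕ → ℕ → Carrier
  cubicFactor₁ k m = (1# - q * q ^ triple m * q ^ double k) * (1# - q ^ 2 * q ^ triple m * (q ^ double k * q ^ double k))
  cubicFactor₂ k m = q * q ^ triple m * q ^ double k

  coeff-0 : ∀ m → coeff 0 (suc m) ≈ coeff 0 m * cubicFactor₁ 0 m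
  coeff-0 m = trans (*-congˡ (base-suc m)) (trans (*-congʳ (*-congˡ (sym (gauss-0 (triple m)))))
    (solve 4 (λ q b x g → :1 :* g :* (b :* ((:1 :- q :* x) :* (:1 :- q :* (q :* x))))
                       := :1 :* g :* b :* ((:1 :- q :* x :* :1) :* (:1 :- q :^ 2 :* x :* (:1 :* :1))))
      refl q (base m) (q ^ triple m) (gauss (triple m) 0)))

  coeff-suc-0 : ∀ k → coeff (suc k) 0 ≈ coeff k 0 * cubicFactor₂ k 0
  coeff-suc-0 k = trans (*-congʳ (*-congʳ (^-square q k)))
    (trans (*-congʳ (*-congʳ (*-congˡ (*-congˡ (sym (^-double k))))))
    (solve 4 (λ q s y b → s :* (q :* y) :* :1 :* b := s :* :1 :* b :* (q :* :1 :* y)) refl q (q ^ (k N.* k)) (q ^ double k) (base 0)))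

  -- Once the common power of q and `base m` are taken out, the recurrence is a relation between
  -- Gaussian binomials at four nearby positions, `gauss-identity`.
  coeff-suc-suc : ∀ k m → coeff (suc k) (suc m) ≈ coeff (suc k) m * cubicFactor₁ (suc k) m + coeff k (suc m) * cubicFactor₂ k (suc m)
  coeff-suc-suc k m = begin
    coeff (suc k) (suc m)
      -- `gauss` at `triple (suc m)` and `double (suc k)` unfolds by definition into `G22` plus
      -- `q ^ triple (suc m)` times `G31`.
      ≈⟨ *-cong (*-congʳ square) (base-suc m) ⟩
    S * (q * Y) * (G22 + q * (q * (q * X)) * G31) * (base m * ((1# - q * X) * (1# - q * (q * X))))
      ≈⟨ solve 8 (λ q X Y S p G22 G30 G31 →
           S :* (q :* Y) :* (G22 :+ q :* (q :* (q :* X)) :* G31) :* (p :* ((:1 :- q :* X) :* (:1 :- q :* (q :* X))))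
           := S :* (q :* Y) :* p :* ((:1 :- q :* X) :* (:1 :- q :^ 2 :* X) :* (G22 :+ q :^ 3 :* X :* G31)))
           refl q X Y S (base m) G22 G30 G31 ⟩
    S * (q * Y) * base m * ((1# - q * X) * (1# - q ^ 2 * X) * (G22 + q ^ 3 * X * G31))
      ≈⟨ *-congˡ (gauss-identity (gauss-pascal′ (suc (suc a)) b)
           (trans (gauss-sucˡ a (suc (suc b))) (*-congˡ (+-congˡ (-‿cong exponent))))
           (trans (gauss-sucˡ (suc a) (suc (suc b))) (*-congˡ (+-congˡ (-‿cong (*-congˡ exponent)))))
           (gauss-cross (suc a) (suc b))) ⟩
    S * (q * Y) * base m * (G02 * (1# - q ^ 3 * X * Y) * (1# - q ^ 6 * X * Y * Y) + q ^ 3 * X * (1# - q * X) * (1# - q ^ 2 * X) * G30)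
      ≈⟨ solve 7 (λ q X Y S p G02 G30 →
           S :* (q :* Y) :* p :* (G02 :* (:1 :- q :^ 3 :* X :* Y) :* (:1 :- q :^ 6 :* X :* Y :* Y) :+ q :^ 3 :* X :* (:1 :- q :* X) :* (:1 :- q :^ 2 :* X) :* G30)
           := S :* (q :* Y) :* G02 :* p :* ((:1 :- q :* X :* (q :* (q :* Y))) :* (:1 :- q :^ 2 :* X :* (q :* (q :* Y) :* (q :* (q :* Y)))))
             :+ S :* G30 :* (p :* ((:1 :- q :* X) :* (:1 :- q :* (q :* X)))) :* (q :* (q :* (q :* (q :* X))) :* Y))
           refl q X Y S (base m) G02 G30 ⟩
    S * (q * Y) * G02 * base m * cubicFactor₁ (suc k) m + S * G30 * (base m * ((1# - q * X) * (1# - q * (q * X)))) * cubicFactor₂ k (suc m)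
      ≈⟨ +-cong (*-congʳ (*-congʳ (*-congʳ square))) (*-congʳ (*-congˡ (base-suc m))) ⟨
    coeff (suc k) m * cubicFactor₁ (suc k) m + coeff k (suc m) * cubicFactor₂ k (suc m) ∎
    where
    a = triple m
    b = double k
    X = q ^ triple m
    Y = q ^ double k
    S = q ^ (k N.* k)
    G02 = gauss a (suc (suc b))
    G22 = gauss (suc (suc a)) (suc (suc b))
    G30 = gauss (suc (suc (suc a))) b
    G31 = gauss (suc (suc (suc a))) (suc b)
    square : q ^ (suc k N.* suc k) ≈ S * (q * Y)
    square = trans (^-square q k) (*-congˡ (*-congˡ (sym (^-double k))))
    exponent : q ^ suc (a N.+ suc (suc b)) ≈ q ^ 3 * X * Y
    exponent = trans (*-congˡ (^-homo-+ q a (suc (suc b))))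
      (solve 3 (λ q X Y → q :* (X :* (q :* (q :* Y))) := q :^ 3 :* X :* Y) refl q X Y)
    -- One Pascal rule and three absorption rules suffice; `G12` and `G21` stand for the binomials
    -- at (a + 1, b + 2) and (a + 2, b + 1), through which the other four are linked.
    gauss-identity : ∀ {G12 G21} →
      G31 ≈ q * Y * G21 + G30 →
      G12 * (1# - q * X) ≈ G02 * (1# - q ^ 3 * X * Y) →
      G22 * (1# - q * (q * X)) ≈ G12 * (1# - q * (q ^ 3 * X * Y)) →
      G21 * (1# - q * (q * X)) ≈ G12 * (1# - q * (q * Y)) →
      (1# - q * X) * (1# - q ^ 2 * X) * (G22 + q ^ 3 * X * G31)
      ≈ G02 * (1# - q ^ 3 * X * Y) * (1# - q ^ 6 * X * Y * Y) + q ^ 3 * X * (1# - q * X) * (1# - q ^ 2 * X) * G30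
    gauss-identity {G12} {G21} h₁ h₂ h₃ h₄ =
      modulo ((1# - q * X) * (1# - q ^ 2 * X) * (q ^ 3 * X)) h₁
      (modulo (1# - q ^ 6 * X * Y * Y) h₂
      (modulo (1# - q * X) h₃
      (modulo ((1# - q * X) * (q ^ 4 * X * Y)) h₄
      (solve 9 (λ q X Y G02 G12 G22 G21 G30 G31 →
        (:1 :- q :* X) :* (:1 :- q :^ 2 :* X) :* (G22 :+ q :^ 3 :* X :* G31)
        := G02 :* (:1 :- q :^ 3 :* X :* Y) :* (:1 :- q :^ 6 :* X :* Y :* Y) :+ q :^ 3 :* X :* (:1 :- q :* X) :* (:1 :- q :^ 2 :* X) :* G30
          :+ (:1 :- q :* X) :* (:1 :- q :^ 2 :* X) :* (q :^ 3 :* X) :* (G31 :- (q :* Y :* G21 :+ G30))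
          :+ (:1 :- q :^ 6 :* X :* Y :* Y) :* (G12 :* (:1 :- q :* X) :- G02 :* (:1 :- q :^ 3 :* X :* Y))
          :+ (:1 :- q :* X) :* (G22 :* (:1 :- q :* (q :* X)) :- G12 :* (:1 :- q :* (q :^ 3 :* X :* Y)))
          :+ (:1 :- q :* X) :* (q :^ 4 :* X :* Y) :* (G21 :* (:1 :- q :* (q :* X)) :- G12 :* (:1 :- q :* (q :* Y))))
        refl q X Y G02 G12 G22 G21 G30 G31))))

-- The case l = 0 with denominators cleared.

module CubicSum {c ℓ} (F : Field c ℓ) (q : Field.Carrier F) where
  open Field F hiding (zero)
  open FieldLemmas F
  open QLemmas F q
  open import Relation.Binary.Reasoning.Setoid setoid

  cubic-expansion : ∀ n x y → x * y ≈ 1# →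
    poch (q * x) q3 n * poch (q * q * y) q3 n ≈ anti n (λ k m → coeff k m * (poch x q k * poch (q * y) q k))
  cubic-expansion zero x y xy≈1 = solve 0 (:1 :* :1 := :1 :* :1 :* (:1 :* :1) :* (:1 :* :1) :+ con (+ 0)) refl
  cubic-expansion (suc n) x y xy≈1 = begin
    poch (q * x) q3 n * (1# - q * x * q3 ^ n) * (poch (q * q * y) q3 n * (1# - q * q * y * q3 ^ n))
      ≈⟨ solve 4 (λ a u b v → a :* u :* (b :* v) := u :* v :* (a :* b)) refl _ _ _ _ ⟩
    factor * (poch (q * x) q3 n * poch (q * q * y) q3 n)
      ≈⟨ *-congˡ (cubic-expansion n x y xy≈1) ⟩
    factor * anti n (λ k m → coeff k m * φ k)                            ≈⟨ anti-* n factor (λ k m → coeff k m * φ k) ⟩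
    anti n (λ k m → factor * (coeff k m * φ k))                          ≈⟨ anti-cong n split ⟩
    anti n (λ k m → u k m + v k m)                                       ≈⟨ anti-+ n u v ⟩
    anti n u + anti n v                                                  ≈⟨ anti-suc n t u v t≈u t≈v t≈u+v ⟨
    anti (suc n) t                                                       ∎
    where
    φ : ℕ → Carrier
    φ k = poch x q k * poch (q * y) q k
    factor = (1# - q * x * q3 ^ n) * (1# - q * q * y * q3 ^ n)
    t u v : ℕ → ℕ → Carrier
    t k m = coeff k m * φ k
    u k m = coeff k m * cubicFactor₁ k m * φ k
    v k m = coeff k m * cubicFactor₂ k m * φ (suc k)
    t≈u : ∀ m → t 0 (suc m) ≈ u 0 m
    t≈u m = *-congʳ (coeff-0 m)
    t≈v : ∀ k → t (suc k) 0 ≈ v k 0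
    t≈v k = *-congʳ (coeff-suc-0 k)
    t≈u+v : ∀ k m → t (suc k) (suc m) ≈ u (suc k) m + v k (suc m)
    t≈u+v k m = trans (*-congʳ (coeff-suc-suc k m)) (distribʳ _ _ _)
    split : ∀ k m → k N.+ m ≡ n → factor * (coeff k m * φ k) ≈ u k m + v k m
    split k m ≡.refl = begin
      factor * (coeff k m * φ k)
        ≈⟨ *-congʳ (*-cong (+-congˡ (-‿cong (*-congˡ power))) (+-congˡ (-‿cong (*-congˡ power)))) ⟩
      (1# - q * x * (B ^ 3 * X)) * (1# - q * q * y * (B ^ 3 * X)) * (coeff k m * φ k)
        ≈⟨ modulo (- (q * X * (B * B)) * (q * (B * B)) * (1# - q * X * (B * B)) * (coeff k m * φ k)) xy≈1
           (solve 8 (λ q x y X B g a b →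
             (:1 :- q :* x :* (B :^ 3 :* X)) :* (:1 :- q :* q :* y :* (B :^ 3 :* X)) :* (g :* (a :* b))
             := g :* ((:1 :- q :* X :* (B :* B)) :* (:1 :- q :^ 2 :* X :* (B :* B :* (B :* B)))) :* (a :* b)
               :+ g :* (q :* X :* (B :* B)) :* (a :* (:1 :- x :* B) :* (b :* (:1 :- q :* y :* B)))
               :+ (:- (q :* X :* (B :* B))) :* (q :* (B :* B)) :* (:1 :- q :* X :* (B :* B)) :* (g :* (a :* b)) :* (x :* y :- :1))
             refl q x y X B (coeff k m) (poch x q k) (poch (q * y) q k)) ⟩
      coeff k m * ((1# - q * X * (B * B)) * (1# - q ^ 2 * X * (B * B * (B * B)))) * φ k + coeff k m * (q * X * (B * B)) * φ (suc k)
        ≈⟨ +-cong (*-congʳ (*-congˡ (*-cong (+-congˡ (-‿cong (*-congˡ D))) (+-congˡ (-‿cong (*-congˡ (*-cong D D)))))))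
                  (*-congʳ (*-congˡ (*-congˡ D))) ⟨
      u k m + v k m ∎
      where
      X = q ^ triple m
      B = q ^ k
      D = ^-double k
      power : q3 ^ (k N.+ m) ≈ B ^ 3 * X
      power = trans (^-homo-+ q3 k m) (*-cong (q3^ k) (sym (^-triple m)))

  -- After (x)_(k+1) = (1 - x)(qx)_k and likewise for y, both summands share (qx)_k (qy)_k, and for
  -- xy = 1 the rest is (1 - x)(1 - q^(k+1) y) + (1 - y)(1 - q^(k+1) x) = (1 + q^(k+1))(1 - x)(1 -
  -- y).
  poch-symmetrise : ∀ x y k → x * y ≈ 1# →
    poch x q k * poch (q * y) q k + poch y q k * poch (q * x) q k ≈ (1# + q ^ k) * (poch x q k * poch y q k)
  poch-symmetrise x y zero xy≈1 = solve 0 (:1 :* :1 :+ :1 :* :1 := (:1 :+ :1) :* (:1 :* :1)) refl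
  poch-symmetrise x y (suc k) xy≈1 = begin
    poch x q (suc k) * poch (q * y) q (suc k) + poch y q (suc k) * poch (q * x) q (suc k)
      ≈⟨ +-cong (*-congʳ (head x)) (*-congʳ (head y)) ⟩
    (1# - x) * poch (q * x) q k * poch (q * y) q (suc k) + (1# - y) * poch (q * y) q k * poch (q * x) q (suc k)
      ≈⟨ modulo ((q * q ^ k - 1#) * (poch (q * x) q k * poch (q * y) q k)) xy≈1 (solve 6 (λ q x y B a b →
           (:1 :- x) :* a :* (b :* (:1 :- q :* y :* B)) :+ (:1 :- y) :* b :* (a :* (:1 :- q :* x :* B))
           := (:1 :+ q :* B) :* ((:1 :- x) :* a :* ((:1 :- y) :* b)) :+ (q :* B :- :1) :* (a :* b) :* (x :* y :- :1))
           refl q x y (q ^ k) (poch (q * x) q k) (poch (q * y) q k)) ⟩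
    (1# + q ^ suc k) * ((1# - x) * poch (q * x) q k * ((1# - y) * poch (q * y) q k))
      ≈⟨ *-congˡ (*-cong (head x) (head y)) ⟨
    (1# + q ^ suc k) * (poch x q (suc k) * poch y q (suc k)) ∎
    where
    head : ∀ x → poch x q (suc k) ≈ (1# - x) * poch (q * x) q k
    head x = trans (poch-head x q k) (*-congˡ (poch-cong q k (*-comm x q)))

  -- The second product is the first with x and y exchanged, so both expansions have the same
  -- coefficients and the basis elements can be symmetrised under the sum.
  cubic-sum : ∀ n x y → x * y ≈ 1# →
    poch (q * x) q3 n * poch (q * q * y) q3 n + poch (q * q * x) q3 n * poch (q * y) q3 n
    ≈ anti n (λ k m → coeff k m * (1# + q ^ k) * (poch x q k * poch y q k))
  cubic-sum n x y xy≈1 = begin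
    poch (q * x) q3 n * poch (q * q * y) q3 n + poch (q * q * x) q3 n * poch (q * y) q3 n
      ≈⟨ +-cong (cubic-expansion n x y xy≈1) (trans (*-comm _ _) (cubic-expansion n y x (trans (*-comm y x) xy≈1))) ⟩
    anti n (λ k m → coeff k m * (poch x q k * poch (q * y) q k)) + anti n (λ k m → coeff k m * (poch y q k * poch (q * x) q k))
      ≈⟨ anti-+ n (λ k m → coeff k m * (poch x q k * poch (q * y) q k)) (λ k m → coeff k m * (poch y q k * poch (q * x) q k)) ⟨
    anti n (λ k m → coeff k m * (poch x q k * poch (q * y) q k) + coeff k m * (poch y q k * poch (q * x) q k))
      ≈⟨ anti-cong n (λ k m _ → trans (sym (distribˡ (coeff k m) _ _)) (trans (*-congˡ (poch-symmetrise x y k xy≈1)) (sym (*-assoc _ _ _)))) ⟩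
    anti n (λ k m → coeff k m * (1# + q ^ k) * (poch x q k * poch y q k)) ∎

  -- Both sides are (-1)_(k+1), peeled from either end. This merges the factor 1 + q^k left by the
  -- symmetrisation with the denominator (-1)_k.
  poch-neg1 : ∀ k → poch (- 1#) q k * (1# + q ^ k) ≈ (1# + 1#) * poch (- q) q k
  poch-neg1 k = begin
    poch (- 1#) q k * (1# + q ^ k)        ≈⟨ *-congˡ (solve 1 (λ B → :1 :+ B := :1 :- (:- :1) :* B) refl (q ^ k)) ⟩
    poch (- 1#) q (suc k)                 ≈⟨ poch-head (- 1#) q k ⟩
    (1# - - 1#) * poch (- 1# * q) q k     ≈⟨ *-cong (solve 0 (:1 :- (:- :1) := :1 :+ :1) refl) (poch-cong q k (solve 1 (λ q → (:- :1) :* q := :- q) refl q)) ⟩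
    (1# + 1#) * poch (- q) q k            ∎

  -- Among the exponents 3m + 1, ..., 3m + 3k, the multiples of 3 make up the symbol in base `q3` on
  -- the right, and the others extend `base m` to `base (k + m)`.
  base-poch : ∀ k m → base m * poch (q ^ suc (triple m)) q (triple k) ≈ base (k N.+ m) * poch (q ^ triple (suc m)) q3 k
  base-poch zero m = refl
  base-poch (suc k) m = begin
    base m * poch (q * X) q (suc (suc (suc (triple k))))
      ≈⟨ *-congˡ (trans (poch-head _ q (suc (suc (triple k)))) (*-congˡ (trans (poch-head _ q (suc (triple k))) (*-congˡ (poch-head _ q (triple k)))))) ⟩
    base m * ((1# - q * X) * ((1# - q * X * q) * ((1# - q * X * q * q) * poch (q * X * q * q * q) q (triple k))))
      ≈⟨ *-congˡ (*-congˡ (*-congˡ (*-congˡ (poch-cong q (triple k) (solve 2 (λ q X → q :* X :* q :* q :* q := q :* (q :* (q :* (q :* X)))) refl q X))))) ⟩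
    base m * ((1# - q * X) * ((1# - q * X * q) * ((1# - q * X * q * q) * poch (q ^ suc (triple (suc m))) q (triple k))))
      ≈⟨ solve 4 (λ q X b P → b :* ((:1 :- q :* X) :* ((:1 :- q :* X :* q) :* ((:1 :- q :* X :* q :* q) :* P)))
           := (:1 :- q :* (q :* (q :* X))) :* (b :* ((:1 :- q :* X) :* (:1 :- q :* (q :* X))) :* P)) refl q X (base m) _ ⟩
    (1# - q ^ triple (suc m)) * (base m * ((1# - q * X) * (1# - q * (q * X))) * poch (q ^ suc (triple (suc m))) q (triple k))
      ≈⟨ *-congˡ (*-congʳ (base-suc m)) ⟨
    (1# - q ^ triple (suc m)) * (base (suc m) * poch (q ^ suc (triple (suc m))) q (triple k))
      ≈⟨ *-congˡ (base-poch k (suc m)) ⟩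
    (1# - q ^ triple (suc m)) * (base (k N.+ suc m) * poch (q ^ triple (suc (suc m))) q3 k)
      ≡⟨ ≡.cong (λ e → (1# - q ^ triple (suc m)) * (base e * poch (q ^ triple (suc (suc m))) q3 k)) (N.+-suc k m) ⟩
    (1# - q ^ triple (suc m)) * (base (suc k N.+ m) * poch (q ^ triple (suc (suc m))) q3 k)
      ≈⟨ solve 3 (λ a b d → a :* (b :* d) := b :* (a :* d)) refl _ _ _ ⟩
    base (suc k N.+ m) * ((1# - q ^ triple (suc m)) * poch (q ^ triple (suc (suc m))) q3 k)
      ≈⟨ *-congˡ (*-congˡ (poch-cong q3 k (solve 2 (λ q X → q :* (q :* (q :* (q :* (q :* (q :* X))))) := q :* (q :* (q :* X)) :* q :^ 3) refl q X))) ⟩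
    base (suc k N.+ m) * ((1# - q ^ triple (suc m)) * poch (q ^ triple (suc m) * q3) q3 k)
      ≈⟨ *-congˡ (poch-head (q ^ triple (suc m)) q3 k) ⟨
    base (suc k N.+ m) * poch (q ^ triple (suc m)) q3 (suc k) ∎
    where X = q ^ triple m

  module _ (r : Carrier) (qr≈1 : q * r ≈ 1#) where

    -- Reversing both products turns negative into positive powers of q. Only the monomials d are compared, as the
    -- products themselves may vanish and cannot be cancelled.
    poch-reverse : ∀ k m → Σ Carrier λ d →
      (poch (r ^ triple (k N.+ m)) q k ≈ d * poch (q ^ suc (triple m N.+ double k)) q k) ×
      (poch (r ^ triple (k N.+ m)) q3 k * q ^ k ≈ d * q ^ (k N.* k) * poch (q ^ triple (suc m)) q3 k)
    poch-reverse zero m = 1# , sym (*-identityˡ _) , sym (*-identityʳ _)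
    poch-reverse (suc k) m with poch-reverse k (suc m)
    -- The new factors 1 - ν B and 1 - ν B³ are reversed by pulling out - ν B and - ν B³. The
    -- surplus B², together with the new q in `q ^ suc k`, is what q^(k²) gains on passing to k + 1,
    -- so one monomial serves both equations.
    ... | d , eq₁ , eq₂ rewrite N.+-suc k m = d * - (ν * B) , lemma₁ , lemma₂
      where
      ν = r ^ triple (suc (k N.+ m))
      B = q ^ k
      X = q ^ triple m
      D = poch (q ^ suc (triple (suc m) N.+ double k)) q k
      W = poch (q ^ triple (suc (suc m))) q3 k
      power : q ^ triple (suc (k N.+ m)) ≈ q ^ 3 * (B ^ 3 * X)
      power = trans (^-triple (suc (k N.+ m))) (*-congˡ (trans (^-homo-+ q3 k m) (*-cong (q3^ k) (sym (^-triple m)))))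
      νq≈1 : q ^ 3 * (B ^ 3 * X) * ν ≈ 1#
      νq≈1 = trans (*-congʳ (sym power)) (^-inverse (triple (suc (k N.+ m))) qr≈1)
      exponent : q ^ (triple m N.+ double (suc k)) ≈ q ^ 2 * X * (B * B)
      exponent = trans (^-homo-+ q (triple m) (double (suc k))) (trans (*-congˡ (*-congˡ (*-congˡ (^-double k))))
        (solve 3 (λ q X B → X :* (q :* (q :* (B :* B))) := q :^ 2 :* X :* (B :* B)) refl q X B))
      D-head : poch (q ^ suc (triple m N.+ double (suc k))) q (suc k) ≈ (1# - q ^ 3 * X * (B * B)) * D
      D-head = trans (poch-head _ q k) (*-cong (+-congˡ (-‿cong lemma)) (poch-cong q k (shifted-power)))
        where
        lemma : q * q ^ (triple m N.+ double (suc k)) ≈ q ^ 3 * X * (B * B)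
        lemma = trans (*-congˡ exponent) (solve 3 (λ q X B → q :* (q :^ 2 :* X :* (B :* B)) := q :^ 3 :* X :* (B :* B)) refl q X B)
        shifted-power : q * q ^ (triple m N.+ double (suc k)) * q ≈ q ^ suc (triple (suc m) N.+ double k)
        shifted-power = trans (*-congʳ lemma) (trans
          (solve 3 (λ q X B → q :^ 3 :* X :* (B :* B) :* q := q :* (q :* (q :* (q :* (X :* (B :* B)))))) refl q X B)
          (*-congˡ (*-congˡ (*-congˡ (*-congˡ (sym (trans (^-homo-+ q (triple m) (double k)) (*-congˡ (^-double k)))))))))
      W-head : poch (q ^ triple (suc m)) q3 (suc k) ≈ (1# - q ^ 3 * X) * W
      W-head = trans (poch-head _ q3 k) (*-cong
        (solve 2 (λ q X → :1 :- q :* (q :* (q :* X)) := :1 :- q :^ 3 :* X) refl q X)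
        (poch-cong q3 k (solve 2 (λ q X → q :* (q :* (q :* X)) :* q :^ 3 := q :* (q :* (q :* (q :* (q :* (q :* X)))))) refl q X)))
      lemma₁ : poch ν q k * (1# - ν * B) ≈ d * - (ν * B) * poch (q ^ suc (triple m N.+ double (suc k))) q (suc k)
      lemma₁ = begin
        poch ν q k * (1# - ν * B)    ≈⟨ *-congʳ eq₁ ⟩
        d * D * (1# - ν * B)
          ≈⟨ modulo (- (d * D)) νq≈1 (solve 6 (λ q X B ν d D →
               d :* D :* (:1 :- ν :* B)
               := d :* (:- (ν :* B)) :* ((:1 :- q :^ 3 :* X :* (B :* B)) :* D) :+ (:- (d :* D)) :* (q :^ 3 :* (B :^ 3 :* X) :* ν :- :1))
               refl q X B ν d D) ⟩
        d * - (ν * B) * ((1# - q ^ 3 * X * (B * B)) * D)  ≈⟨ *-congˡ D-head ⟨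
        d * - (ν * B) * poch (q ^ suc (triple m N.+ double (suc k))) q (suc k) ∎
      lemma₂ : poch ν q3 k * (1# - ν * q3 ^ k) * q ^ suc k ≈ d * - (ν * B) * q ^ (suc k N.* suc k) * poch (q ^ triple (suc m)) q3 (suc k)
      lemma₂ = begin
        poch ν q3 k * (1# - ν * q3 ^ k) * (q * B)   ≈⟨ *-congʳ (*-congˡ (+-congˡ (-‿cong (*-congˡ (q3^ k))))) ⟩
        poch ν q3 k * (1# - ν * B ^ 3) * (q * B)    ≈⟨ solve 4 (λ q B ν Z → Z :* (:1 :- ν :* B :^ 3) :* (q :* B) := Z :* B :* (q :* (:1 :- ν :* B :^ 3))) refl q B ν _ ⟩
        poch ν q3 k * B * (q * (1# - ν * B ^ 3))    ≈⟨ *-congʳ eq₂ ⟩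
        d * S * W * (q * (1# - ν * B ^ 3))
          ≈⟨ modulo (- (d * S * W * q)) νq≈1 (solve 7 (λ q X B ν d S W →
               d :* S :* W :* (q :* (:1 :- ν :* B :^ 3))
               := d :* (:- (ν :* B)) :* (S :* (q :* (B :* B))) :* ((:1 :- q :^ 3 :* X) :* W) :+ (:- (d :* S :* W :* q)) :* (q :^ 3 :* (B :^ 3 :* X) :* ν :- :1))
               refl q X B ν d S W) ⟩
        d * - (ν * B) * (S * (q * (B * B))) * ((1# - q ^ 3 * X) * W)   ≈⟨ *-cong (*-congˡ (^-square q k)) W-head ⟨
        d * - (ν * B) * q ^ (suc k N.* suc k) * poch (q ^ triple (suc m)) q3 (suc k) ∎
        where S = q ^ (k N.* k)

    module _ (s : Carrier) (ss≈q : s * s ≈ q) where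

      -- By s² = q, (s)_k (-s)_k = (q;q²)_k, while (q)_k (-q)_k = (q²;q²)_k; the odd and even
      -- exponents interleave.
      poch-double : ∀ k → poch s q k * poch (- s) q k * poch q q k * poch (- q) q k ≈ poch q q (double k)
      poch-double zero = solve 0 (:1 :* :1 :* :1 :* :1 := :1) refl
      poch-double (suc k) = begin
        poch s q (suc k) * poch (- s) q (suc k) * poch q q (suc k) * poch (- q) q (suc k)
          ≈⟨ modulo (- (a * b * e * f * (B * B) * (1# - q * (q * (B * B))))) ss≈q (solve 7 (λ q s B a b e f →
             a :* (:1 :- s :* B) :* (b :* (:1 :- (:- s) :* B)) :* (e :* (:1 :- q :* B)) :* (f :* (:1 :- (:- q) :* B))
             := a :* b :* e :* f :* (:1 :- q :* (B :* B)) :* (:1 :- q :* (q :* (B :* B)))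
               :+ (:- (a :* b :* e :* f :* (B :* B) :* (:1 :- q :* (q :* (B :* B))))) :* (s :* s :- q))
             refl q s B a b e f) ⟩
        a * b * e * f * (1# - q * (B * B)) * (1# - q * (q * (B * B)))
          ≈⟨ *-cong (*-cong (poch-double k) (+-congˡ (-‿cong (*-congˡ (sym (^-double k)))))) (+-congˡ (-‿cong (*-congˡ (*-congˡ (sym (^-double k)))))) ⟩
        poch q q (double (suc k)) ∎
        where
        B = q ^ k
        a = poch s q k
        b = poch (- s) q k
        e = poch q q k
        f = poch (- q) q k

      -- Identifies `coeff` with the coefficient in the hypergeometric sum: the denominators
      -- collapse to 2 (q)_(2k), the Gaussian binomial turns (q)_(2k) into (q^(3m+1))_(2k), and the
      -- reversed (q^(-3n))_k, n = k + m, continues this to (q^(3m+1))_(3k), which `base-poch`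
      -- splits.
      coeff-poch : ∀ k m →
        coeff k m * (1# + q ^ k) * (poch q q k * poch (- 1#) q k * poch s q k * poch (- s) q k * poch (r ^ triple (k N.+ m)) q k)
        ≈ (1# + 1#) * base (k N.+ m) * (poch (r ^ triple (k N.+ m)) q3 k * q ^ k)
      coeff-poch k m with poch-reverse k m
      ... | d , eq₁ , eq₂ = begin
        S * G * b * (1# + q ^ k) * (e * u * a * a′ * R)
          ≈⟨ solve 9 (λ S G b B e u a a′ R → S :* G :* b :* (:1 :+ B) :* (e :* u :* a :* a′ :* R) := S :* b :* R :* G :* (a :* a′ :* e :* (u :* (:1 :+ B))))
               refl S G b (q ^ k) e u a a′ R ⟩
        S * b * R * G * (a * a′ * e * (u * (1# + q ^ k)))
          ≈⟨ *-cong (*-congʳ (*-congˡ eq₁)) (*-congˡ (poch-neg1 k)) ⟩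
        S * b * (d * D) * G * (a * a′ * e * ((1# + 1#) * f))
          ≈⟨ solve 9 (λ S b d D G a a′ e f → S :* b :* (d :* D) :* G :* (a :* a′ :* e :* ((:1 :+ :1) :* f))
               := (:1 :+ :1) :* d :* S :* (b :* (G :* (a :* a′ :* e :* f) :* D))) refl S b d D G a a′ e f ⟩
        (1# + 1#) * d * S * (b * (G * (a * a′ * e * f) * D))
          ≈⟨ *-congˡ (*-congˡ (*-congʳ (trans (*-congˡ (poch-double k)) (gauss-pochʳ (triple m) (double k))))) ⟩
        (1# + 1#) * d * S * (b * (poch (q ^ suc (triple m)) q (double k) * D))
          ≈⟨ *-congˡ (*-congˡ (*-congˡ (poch-cong q k (^-homo-+ q (suc (triple m)) (double k))))) ⟩
        (1# + 1#) * d * S * (b * (poch (q ^ suc (triple m)) q (double k) * poch (q ^ suc (triple m) * q ^ double k) q k))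
          ≈⟨ *-congˡ (*-congˡ (poch-+ (q ^ suc (triple m)) q (double k) k)) ⟨
        (1# + 1#) * d * S * (b * poch (q ^ suc (triple m)) q (double k N.+ k))
          ≡⟨ ≡.cong (λ e → (1# + 1#) * d * S * (b * poch (q ^ suc (triple m)) q e)) (≡.sym (triple-double k)) ⟩
        (1# + 1#) * d * S * (b * poch (q ^ suc (triple m)) q (triple k))
          ≈⟨ *-congˡ (base-poch k m) ⟩
        (1# + 1#) * d * S * (base (k N.+ m) * W)
          ≈⟨ solve 5 (λ t d S b W → t :* d :* S :* (b :* W) := t :* b :* (d :* S :* W)) refl (1# + 1#) d S (base (k N.+ m)) W ⟩
        (1# + 1#) * base (k N.+ m) * (d * S * W)
          ≈⟨ *-congˡ eq₂ ⟨
        (1# + 1#) * base (k N.+ m) * (poch (r ^ triple (k N.+ m)) q3 k * q ^ k) ∎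
        where
        S = q ^ (k N.* k)
        G = gauss (triple m) (double k)
        b = base m
        e = poch q q k
        u = poch (- 1#) q k
        a = poch s q k
        a′ = poch (- s) q k
        f = poch (- q) q k
        R = poch (r ^ triple (k N.+ m)) q k
        D = poch (q ^ suc (triple m N.+ double k)) q k
        W = poch (q ^ triple (suc m)) q3 k

-- The connection formula that reduces general l to l = 0.

module Connection {c ℓ} (F : Field c ℓ) (q r s : Field.Carrier F)
  (qr≈1 : Field._≈_ F (Field._*_ F q r) (Field.1# F))
  (ss≈q : Field._≈_ F (Field._*_ F s s) q) where
  open Field F hiding (zero)
  open FieldLemmas F
  open QLemmas F q
  open CubicSum F q
  open import Relation.Binary.Reasoning.Setoid setoid

  -- shift l k is (s;q)_l (s;q)_k / (s q^(-l);q)_k.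
  shift : ℕ → ℕ → Carrier
  shift zero    k = 1#
  shift (suc l) k = shift l k * (q ^ k - q ^ l * s)

  -- For a = s q^(-l-1), s² = q gives q^l s a = 1. Hence the new factor q^k - q^l s is - q^l s (1 -
  -- a q^k), which extends (a)_k to (a)_(k+1), and the first factor 1 - a of the latter becomes 1 -
  -- s q^l.
  shift-poch : ∀ l k → shift l k * poch (s * r ^ l) q k ≈ poch s q l * poch s q k
  shift-poch zero k = *-congˡ (poch-cong q k (*-identityʳ s))
  shift-poch (suc l) k = begin
    e * (q ^ k - Q * s) * poch a q k
      ≈⟨ *-congʳ (*-congˡ lemma) ⟩
    e * (- (Q * s) * (1# - a * q ^ k)) * poch a q k
      ≈⟨ solve 4 (λ e u v p → e :* (u :* v) :* p := e :* u :* (p :* v)) refl e (- (Q * s)) (1# - a * q ^ k) (poch a q k) ⟩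
    e * - (Q * s) * poch a q (suc k)
      ≈⟨ *-congˡ (poch-head a q k) ⟩
    e * - (Q * s) * ((1# - a) * poch (a * q) q k)
      ≈⟨ *-congˡ (*-congˡ (poch-cong q k (modulo (s * r ^ l) qr≈1
           (solve 4 (λ q r s R → s :* (r :* R) :* q := s :* R :+ s :* R :* (q :* r :- :1)) refl q r s (r ^ l))))) ⟩
    e * - (Q * s) * ((1# - a) * poch (s * r ^ l) q k)
      ≈⟨ solve 4 (λ e u v p → e :* u :* (v :* p) := u :* v :* (e :* p)) refl e (- (Q * s)) (1# - a) (poch (s * r ^ l) q k) ⟩
    - (Q * s) * (1# - a) * (e * poch (s * r ^ l) q k)
      ≈⟨ *-cong lemma′ (shift-poch l k) ⟩
    (1# - s * Q) * (poch s q l * poch s q k)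
      ≈⟨ solve 3 (λ u v p → u :* (v :* p) := v :* u :* p) refl (1# - s * Q) (poch s q l) (poch s q k) ⟩
    poch s q (suc l) * poch s q k ∎
    where
    e = shift l k
    Q = q ^ l
    a = s * r ^ suc l
    Qsa≈1 : Q * s * a ≈ 1#
    Qsa≈1 = modulo (Q * r ^ suc l) ss≈q (modulo 1# (^-inverse (suc l) qr≈1)
      (solve 4 (λ q s Q R → Q :* s :* (s :* R) := :1 :+ Q :* R :* (s :* s :- q) :+ :1 :* (q :* Q :* R :- :1)) refl q s Q (r ^ suc l)))
    lemma : q ^ k - Q * s ≈ - (Q * s) * (1# - a * q ^ k)
    lemma = modulo (- q ^ k) Qsa≈1 (solve 4 (λ Q s a B → B :- Q :* s := (:- (Q :* s)) :* (:1 :- a :* B) :+ (:- B) :* (Q :* s :* a :- :1)) refl Q s a (q ^ k))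
    lemma′ : - (Q * s) * (1# - a) ≈ 1# - s * Q
    lemma′ = modulo 1# Qsa≈1 (solve 3 (λ Q s a → (:- (Q :* s)) :* (:1 :- a) := :1 :- s :* Q :+ :1 :* (Q :* s :* a :- :1)) refl Q s a)

  -- As i² and i have the same parity, this is (-1)^i q^(i²/2).
  sign : ℕ → Carrier
  sign i = (- s) ^ (i N.* i)

  sign-suc : ∀ i → sign (suc i) ≈ - s * q ^ i * sign i
  sign-suc i = begin
    (- s) ^ (suc i N.* suc i)                    ≈⟨ ^-square (- s) i ⟩
    sign i * (- s * ((- s) ^ i * (- s) ^ i))     ≈⟨ *-congˡ (*-congˡ (^-distrib-* (- s) (- s) i)) ⟨
    sign i * (- s * (- s * - s) ^ i)
      ≈⟨ *-congˡ (*-congˡ (^-cong i (trans (solve 1 (λ s → (:- s) :* (:- s) := s :* s) refl s) ss≈q))) ⟩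
    sign i * (- s * q ^ i)                       ≈⟨ *-comm _ _ ⟩
    - s * q ^ i * sign i                         ∎

  -- signedGauss i (l - i) is q^((l + 1/2) i) (q^(-l);q)_i / (q;q)_i.
  signedGauss : ℕ → ℕ → Carrier
  signedGauss i j = sign i * gauss i j

  signedGauss-poch : ∀ i j → s ^ (suc (double (i N.+ j)) N.* i) * poch (r ^ (i N.+ j)) q i ≈ signedGauss i j * poch q q i
  signedGauss-poch i j = begin
    s ^ (suc (double (i N.+ j)) N.* i) * poch (r ^ (i N.+ j)) q i
      ≡⟨ ≡.cong (λ e → s ^ e * poch (r ^ (i N.+ j)) q i) (N.*-comm (suc (double (i N.+ j))) i) ⟩
    s ^ (i N.* suc (double (i N.+ j))) * poch (r ^ (i N.+ j)) q i
      ≈⟨ *-congʳ (^-assoc s (suc (double (i N.+ j))) i) ⟨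
    (s * s ^ double (i N.+ j)) ^ i * poch (r ^ (i N.+ j)) q i
      ≈⟨ *-congʳ (^-cong i (*-congˡ (s^double (i N.+ j)))) ⟩
    (s * q ^ (i N.+ j)) ^ i * poch (r ^ (i N.+ j)) q i   ≈⟨ reverse i j ⟩
    sign i * poch (q ^ suc j) q i                        ≈⟨ *-congˡ (gauss-pochˡ i j) ⟨
    sign i * (gauss i j * poch q q i)                    ≈⟨ *-assoc _ _ _ ⟨
    signedGauss i j * poch q q i                         ∎
    where
    s^double : ∀ n → s ^ double n ≈ q ^ n
    s^double zero = refl
    s^double (suc n) = trans (sym (*-assoc s s _)) (*-cong ss≈q (s^double n))

    -- The induction lowers i and raises j, so that l = i + j stays fixed; the factor split off is
    -- q^l (1 - q^(-l) q^i) = - q^i (1 - q^(j+1)).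
    reverse : ∀ i j → (s * q ^ (i N.+ j)) ^ i * poch (r ^ (i N.+ j)) q i ≈ sign i * poch (q ^ suc j) q i
    reverse zero j = refl
    reverse (suc i) j = begin
      s * Q * (s * Q) ^ i * (poch ν q i * (1# - ν * q ^ i))
        ≈⟨ solve 5 (λ s Q p h v → s :* Q :* p :* (h :* v) := s :* (Q :* v) :* (p :* h)) refl s Q ((s * Q) ^ i) (poch ν q i) (1# - ν * q ^ i) ⟩
      s * (Q * (1# - ν * q ^ i)) * ((s * Q) ^ i * poch ν q i)
        ≈⟨ *-cong (*-congˡ lemma) IH ⟩
      s * (- q ^ i * (1# - q ^ suc j)) * (sign i * poch (q ^ suc (suc j)) q i)
        ≈⟨ solve 5 (λ s A v σ p → s :* ((:- A) :* v) :* (σ :* p) := (:- s) :* A :* σ :* (v :* p)) refl s (q ^ i) (1# - q ^ suc j) (sign i) _ ⟩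
      - s * q ^ i * sign i * ((1# - q ^ suc j) * poch (q ^ suc (suc j)) q i)
        ≈⟨ *-cong (sign-suc i) (trans (poch-head (q ^ suc j) q i) (*-congˡ (poch-cong q i (*-comm _ _)))) ⟨
      sign (suc i) * poch (q ^ suc j) q (suc i) ∎
      where
      Q = q ^ (suc i N.+ j)
      ν = r ^ (suc i N.+ j)
      IH : (s * Q) ^ i * poch ν q i ≈ sign i * poch (q ^ suc (suc j)) q i
      IH = ≡.subst (λ e → (s * q ^ e) ^ i * poch (r ^ e) q i ≈ sign i * poch (q ^ suc (suc j)) q i) (N.+-suc i j) (reverse i (suc j))
      lemma : Q * (1# - ν * q ^ i) ≈ - q ^ i * (1# - q ^ suc j)
      lemma = modulo (- q ^ i) (^-inverse (suc i N.+ j) qr≈1) (modulo 1# (*-congˡ (^-homo-+ q i j))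
        (solve 5 (λ q Q ν A B → Q :* (:1 :- ν :* A) := (:- A) :* (:1 :- q :* B) :+ (:- A) :* (Q :* ν :- :1) :+ :1 :* (Q :- q :* (A :* B)))
          refl q Q ν (q ^ i) (q ^ j)))

  -- When the first factor is multiplied out, `gauss-pascal′` is applied to the term without z and
  -- the defining rule of `gauss` to the term with z; this choice makes both resulting coefficients
  -- factorise.
  signedGauss-pascal : ∀ i j z →
    (1# - q ^ suc (suc (i N.+ j)) * z) * signedGauss (suc i) (suc j)
    ≈ signedGauss (suc i) j * (1# - q ^ suc (double (suc i) N.+ j) * z)
      + - s * q ^ suc (i N.+ j) * (1# - z * q ^ suc i) * signedGauss i (suc j)
  signedGauss-pascal i j z = begin
    (1# - q ^ suc (suc (i N.+ j)) * z) * (sign (suc i) * G11)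
      ≈⟨ *-cong (+-congˡ (-‿cong (*-congʳ (*-congˡ (*-congˡ (^-homo-+ q i j)))))) (*-congʳ (sign-suc i)) ⟩
    (1# - q * (q * (A * B)) * z) * (- s * A * σ * G11)
      ≈⟨ modulo (- s * A * σ) (gauss-pascal′ i j)
           (solve 8 (λ q s A B σ z G01 G10 →
              let G11 = G01 :+ q :* A :* G10 in
              (:1 :- q :* (q :* (A :* B)) :* z) :* ((:- s) :* A :* σ :* G11)
              := (:- s) :* A :* σ :* G10 :* (:1 :- q :* (q :* (q :* (A :* A :* B))) :* z) :+ (:- s) :* (q :* (A :* B)) :* (:1 :- z :* (q :* A)) :* (σ :* G01)
                :+ (:- s) :* A :* σ :* (G11 :- (q :* B :* G01 :+ G10)))
              refl q s A B σ z G01 G10) ⟩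
    - s * A * σ * G10 * (1# - q * (q * (q * (A * A * B))) * z) + - s * (q * (A * B)) * (1# - z * (q * A)) * (σ * G01)
      ≈⟨ +-cong (*-cong (*-congʳ (sign-suc i)) (+-congˡ (-‿cong (*-congʳ (*-congˡ (*-congˡ (*-congˡ
           (trans (^-homo-+ q (double i) j) (*-congʳ (^-double i))))))))))
           (*-congʳ (*-congʳ (*-congˡ (*-congˡ (^-homo-+ q i j))))) ⟨
    sign (suc i) * G10 * (1# - q ^ suc (double (suc i) N.+ j) * z) + - s * q ^ suc (i N.+ j) * (1# - z * q ^ suc i) * (σ * G01) ∎
    where
    A = q ^ i
    B = q ^ j
    σ = sign i
    G11 = gauss (suc i) (suc j)
    G01 = gauss i (suc j)
    G10 = gauss (suc i) j

  -- With l = i + j, this is (1 + x q^i) (x²;q)_i / (x² q^(l+1);q)_i after multiplication by (x² q^(l+1);q)_l.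
  weight : ℕ → ℕ → Carrier → Carrier
  weight i j x = (1# + x * q ^ i) * poch (x * x) q i * poch (q ^ suc (double i N.+ j) * (x * x)) q j

  -- Restoring the missing first factor turns the last symbol of `weight i (suc j) x` into that of
  -- `weight i j x` with two more factors at the end. Their exponents depend on i + j alone, so they
  -- come out of a sum over an antidiagonal.
  weight-suc : ∀ i j x → (1# - q ^ suc (double i N.+ j) * (x * x)) * weight i (suc j) x
    ≈ (1# - q ^ suc (double (i N.+ j)) * (x * x)) * (1# - q ^ suc (suc (double (i N.+ j))) * (x * x)) * weight i j x
  weight-suc i j x = begin
    (1# - a) * (h * poch (q ^ suc (double i N.+ suc j) * z) q (suc j))
      ≈⟨ *-congˡ (*-congˡ (poch-cong q (suc j) (trans (*-congʳ (reflexive (≡.cong (λ e → q * q ^ e) (N.+-suc (double i) j))))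
           (solve 3 (λ q b z → q :* b :* z := b :* z :* q) refl q (q ^ suc (double i N.+ j)) z)))) ⟩
    (1# - a) * (h * poch (a * q) q (suc j))
      ≈⟨ solve 3 (λ u h p → u :* (h :* p) := h :* (u :* p)) refl (1# - a) h (poch (a * q) q (suc j)) ⟩
    h * ((1# - a) * poch (a * q) q (suc j))
      ≈⟨ *-congˡ (poch-head a q (suc j)) ⟨
    h * (poch a q j * (1# - a * q ^ j) * (1# - a * (q * q ^ j)))
      ≈⟨ *-congˡ (*-cong (*-congˡ (+-congˡ (-‿cong exponent₁))) (+-congˡ (-‿cong exponent₂))) ⟩
    h * (poch a q j * (1# - q ^ suc (double (i N.+ j)) * z) * (1# - q ^ suc (suc (double (i N.+ j))) * z))
      ≈⟨ solve 4 (λ h p u v → h :* (p :* u :* v) := u :* v :* (h :* p)) refl h (poch a q j) _ _ ⟩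
    (1# - q ^ suc (double (i N.+ j)) * z) * (1# - q ^ suc (suc (double (i N.+ j))) * z) * weight i j x ∎
    where
    z = x * x
    a = q ^ suc (double i N.+ j) * z
    h = (1# + x * q ^ i) * poch z q i
    A = q ^ i
    B = q ^ j
    a≈ : a ≈ q * (A * A * B) * z
    a≈ = *-congʳ (*-congˡ (trans (^-homo-+ q (double i) j) (*-congʳ (^-double i))))
    power : q ^ double (i N.+ j) ≈ A * B * (A * B)
    power = trans (^-double (i N.+ j)) (*-cong (^-homo-+ q i j) (^-homo-+ q i j))
    exponent₁ : a * B ≈ q ^ suc (double (i N.+ j)) * z
    exponent₁ = trans (*-congʳ a≈) (trans (solve 4 (λ q A B z → q :* (A :* A :* B) :* z :* B := q :* (A :* B :* (A :* B)) :* z) refl q A B z)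
      (*-congʳ (*-congˡ (sym power))))
    exponent₂ : a * (q * B) ≈ q ^ suc (suc (double (i N.+ j))) * z
    exponent₂ = trans (*-congʳ a≈) (trans (solve 4 (λ q A B z → q :* (A :* A :* B) :* z :* (q :* B) := q :* (q :* (A :* B :* (A :* B))) :* z) refl q A B z)
      (*-congʳ (*-congˡ (*-congˡ (sym power)))))

  -- Replacing x by qx multiplies x² by q², so (1 - x²)(1 - q x²) completes (q² x²)_i to (x²)_(i+2),
  -- and the last symbol is already the one at (i + 1, j). A shift in x thus becomes a shift in i.
  weight-shift : ∀ i j x → (1# - x * x) * (1# - q * (x * x)) * weight i j (q * x) ≈ (1# - x * x * q ^ suc i) * weight (suc i) j x
  weight-shift i j x = begin
    (1# - z) * (1# - q * z) * ((1# + q * x * q ^ i) * poch (q * x * (q * x)) q i * poch (q ^ suc (double i N.+ j) * (q * x * (q * x))) q j)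
      ≈⟨ *-congˡ (*-cong (*-congˡ (poch-cong q i (solve 2 (λ q x → q :* x :* (q :* x) := x :* x :* q :* q) refl q x)))
           (poch-cong q j (solve 3 (λ q b x → q :* b :* (q :* x :* (q :* x)) := q :* (q :* (q :* b)) :* (x :* x)) refl q (q ^ (double i N.+ j)) x))) ⟩
    (1# - z) * (1# - q * z) * ((1# + q * x * q ^ i) * poch (z * q * q) q i * P)
      ≈⟨ solve 6 (λ q x z A p P → (:1 :- z) :* (:1 :- q :* z) :* ((:1 :+ q :* x :* A) :* p :* P)
           := (:1 :- z) :* ((:1 :- z :* q) :* p) :* ((:1 :+ x :* (q :* A)) :* P)) refl q x z (q ^ i) (poch (z * q * q) q i) P ⟩
    (1# - z) * ((1# - z * q) * poch (z * q * q) q i) * ((1# + x * q ^ suc i) * P)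
      ≈⟨ *-congʳ (trans (poch-head z q (suc i)) (*-congˡ (poch-head (z * q) q i))) ⟨
    poch z q (suc i) * (1# - z * q ^ suc i) * ((1# + x * q ^ suc i) * P)
      ≈⟨ solve 4 (λ p u v P → p :* u :* (v :* P) := u :* (v :* p :* P)) refl _ _ _ _ ⟩
    (1# - z * q ^ suc i) * weight (suc i) j x ∎
    where
    z = x * x
    P = poch (q ^ suc (double (suc i) N.+ j) * z) q j

  module _ (k : ℕ) where

    pair : ℕ → Carrier → Carrier → Carrier
    pair i x y = poch (q ^ i * x) q k * poch (r ^ i * y) q k

    pair-shift : ∀ i x y → pair i (q * x) (r * y) ≈ pair (suc i) x y
    pair-shift i x y = *-cong (poch-cong q k (solve 3 (λ q A x → A :* (q :* x) := q :* A :* x) refl q (q ^ i) x))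
      (poch-cong q k (solve 3 (λ q A x → A :* (q :* x) := q :* A :* x) refl r (r ^ i) y))

    term : ℕ → ℕ → Carrier → Carrier → Carrier
    term i j x y = signedGauss i j * weight i j x * pair i x y

    rightSum : ℕ → Carrier → Carrier → Carrier
    rightSum l x y = anti l (λ i j → term i j x y)

    -- Since `weight-shift` and `pair-shift` turn x -> qx into i -> i + 1, all three sums involve
    -- the same products `pair i x y`, and their coefficients are related by `signedGauss-pascal` at
    -- z = x².
    rightSum-suc : ∀ l x y →
      (1# - q ^ suc l * (x * x)) * rightSum (suc l) x y
      ≈ (1# - q ^ suc (double l) * (x * x)) * (1# - q ^ suc (suc (double l)) * (x * x)) * rightSum l x y
        + - s * q ^ l * ((1# - x * x) * (1# - q * (x * x))) * rightSum l (q * x) (r * y)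
    rightSum-suc l x y = begin
      (1# - q ^ suc l * z) * rightSum (suc l) x y
        ≈⟨ anti-* (suc l) (1# - q ^ suc l * z) (λ i j → term i j x y) ⟩
      anti (suc l) (λ i j → (1# - q ^ suc l * z) * term i j x y)
        -- Factors in l are rewritten in i + j, because the hypotheses of `anti-suc` compare entries
        -- without fixing an antidiagonal.
        ≈⟨ anti-cong (suc l) (λ i j eq → *-congʳ {term i j x y} (reflexive (≡.cong (λ e → 1# - q ^ e * z) (≡.sym eq)))) ⟩
      anti (suc l) t
        ≈⟨ anti-suc l t u v t≈u t≈v t≈u+v ⟩
      anti l u + anti l v
        ≈⟨ +-cong (anti-cong l (λ i j eq → *-congʳ {term i j x y} (reflexive (≡.cong factor₁ eq))))
                  (anti-cong l (λ i j eq → *-congʳ {term i j (q * x) (r * y)} (reflexive (≡.cong factor₂ eq)))) ⟩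
      anti l (λ i j → factor₁ l * term i j x y) + anti l (λ i j → factor₂ l * term i j (q * x) (r * y))
        ≈⟨ +-cong (anti-* l (factor₁ l) (λ i j → term i j x y)) (anti-* l (factor₂ l) (λ i j → term i j (q * x) (r * y))) ⟨
      factor₁ l * rightSum l x y + factor₂ l * rightSum l (q * x) (r * y) ∎
      where
      z = x * x
      factor₁ factor₂ : ℕ → Carrier
      factor₁ e = (1# - q ^ suc (double e) * z) * (1# - q ^ suc (suc (double e)) * z)
      factor₂ e = - s * q ^ e * ((1# - z) * (1# - q * z))
      t u v : ℕ → ℕ → Carrier
      t i j = (1# - q ^ (i N.+ j) * z) * term i j x y
      u i j = factor₁ (i N.+ j) * term i j x y
      v i j = factor₂ (i N.+ j) * term i j (q * x) (r * y)
      u-eq : ∀ i j → u i j ≈ signedGauss i j * (1# - q ^ suc (double i N.+ j) * z) * (weight i (suc j) x * pair i x y)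
      u-eq i j = begin
        factor₁ (i N.+ j) * (signedGauss i j * weight i j x * pair i x y)
          ≈⟨ solve 4 (λ f g w p → f :* (g :* w :* p) := g :* (f :* w) :* p) refl (factor₁ (i N.+ j)) (signedGauss i j) (weight i j x) (pair i x y) ⟩
        signedGauss i j * (factor₁ (i N.+ j) * weight i j x) * pair i x y
          ≈⟨ *-congʳ (*-congˡ (weight-suc i j x)) ⟨
        signedGauss i j * ((1# - q ^ suc (double i N.+ j) * z) * weight i (suc j) x) * pair i x y
          ≈⟨ solve 4 (λ f g w p → g :* (f :* w) :* p := g :* f :* (w :* p)) refl _ _ _ _ ⟩
        signedGauss i j * (1# - q ^ suc (double i N.+ j) * z) * (weight i (suc j) x * pair i x y) ∎
      v-eq : ∀ i j → v i j ≈ - s * q ^ (i N.+ j) * (1# - z * q ^ suc i) * signedGauss i j * (weight (suc i) j x * pair (suc i) x y)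
      v-eq i j = begin
        - s * q ^ (i N.+ j) * ((1# - z) * (1# - q * z)) * (signedGauss i j * weight i j (q * x) * pair i (q * x) (r * y))
          ≈⟨ solve 5 (λ f e g w p → f :* e :* (g :* w :* p) := f :* g :* (e :* w) :* p) refl
               (- s * q ^ (i N.+ j)) ((1# - z) * (1# - q * z)) (signedGauss i j) (weight i j (q * x)) (pair i (q * x) (r * y)) ⟩
        - s * q ^ (i N.+ j) * signedGauss i j * ((1# - z) * (1# - q * z) * weight i j (q * x)) * pair i (q * x) (r * y)
          ≈⟨ *-cong (*-congˡ (weight-shift i j x)) (pair-shift i x y) ⟩
        - s * q ^ (i N.+ j) * signedGauss i j * ((1# - z * q ^ suc i) * weight (suc i) j x) * pair (suc i) x y
          ≈⟨ solve 5 (λ f e g w p → f :* g :* (e :* w) :* p := f :* e :* g :* (w :* p)) refl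
               (- s * q ^ (i N.+ j)) (1# - z * q ^ suc i) (signedGauss i j) (weight (suc i) j x) (pair (suc i) x y) ⟩
        - s * q ^ (i N.+ j) * (1# - z * q ^ suc i) * signedGauss i j * (weight (suc i) j x * pair (suc i) x y) ∎
      t≈u : ∀ j → t 0 (suc j) ≈ u 0 j
      t≈u j = trans (solve 4 (λ f g w p → f :* (g :* w :* p) := g :* f :* (w :* p)) refl
        (1# - q ^ suc j * z) (signedGauss 0 (suc j)) (weight 0 (suc j) x) (pair 0 x y)) (sym (u-eq 0 j))
      t≈v : ∀ i → t (suc i) 0 ≈ v i 0
      t≈v i = trans (*-cong (+-congˡ (-‿cong (*-congʳ (*-congˡ i+0)))) (*-congʳ (*-congʳ (*-congʳ (sign-suc i)))))
        (trans (solve 7 (λ q s A z σ w p → (:1 :- q :* A :* z) :* ((:- s) :* A :* σ :* :1 :* w :* p)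
             := (:- s) :* A :* (:1 :- z :* (q :* A)) :* (σ :* :1) :* (w :* p)) refl q s (q ^ i) z (sign i) (weight (suc i) 0 x) (pair (suc i) x y))
        (trans (*-congʳ (*-cong (*-congʳ (*-congˡ (sym i+0))) (*-congˡ (sym (gauss-0 i))))) (sym (v-eq i 0))))
        where
        i+0 : q ^ (i N.+ 0) ≈ q ^ i
        i+0 = reflexive (≡.cong (q ^_) (N.+-identityʳ i))
      t≈u+v : ∀ i j → t (suc i) (suc j) ≈ u (suc i) j + v i (suc j)
      t≈u+v i j = begin
        (1# - q ^ suc (i N.+ suc j) * z) * (signedGauss (suc i) (suc j) * W * P)
          ≡⟨ ≡.cong (λ e → (1# - q ^ suc e * z) * (signedGauss (suc i) (suc j) * W * P)) (N.+-suc i j) ⟩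
        (1# - q ^ suc (suc (i N.+ j)) * z) * (signedGauss (suc i) (suc j) * W * P)
          ≈⟨ solve 4 (λ f g w p → f :* (g :* w :* p) := f :* g :* (w :* p)) refl (1# - q ^ suc (suc (i N.+ j)) * z) (signedGauss (suc i) (suc j)) W P ⟩
        (1# - q ^ suc (suc (i N.+ j)) * z) * signedGauss (suc i) (suc j) * (W * P)
          ≈⟨ *-congʳ (signedGauss-pascal i j z) ⟩
        (signedGauss (suc i) j * (1# - q ^ suc (double (suc i) N.+ j) * z)
          + - s * q ^ suc (i N.+ j) * (1# - z * q ^ suc i) * signedGauss i (suc j)) * (W * P)
          ≈⟨ distribʳ _ _ _ ⟩
        signedGauss (suc i) j * (1# - q ^ suc (double (suc i) N.+ j) * z) * (W * P)
          + - s * q ^ suc (i N.+ j) * (1# - z * q ^ suc i) * signedGauss i (suc j) * (W * P)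
          ≡⟨ ≡.cong (λ e → signedGauss (suc i) j * (1# - q ^ suc (double (suc i) N.+ j) * z) * (W * P)
               + - s * q ^ e * (1# - z * q ^ suc i) * signedGauss i (suc j) * (W * P)) (≡.sym (N.+-suc i j)) ⟩
        signedGauss (suc i) j * (1# - q ^ suc (double (suc i) N.+ j) * z) * (W * P)
          + - s * q ^ (i N.+ suc j) * (1# - z * q ^ suc i) * signedGauss i (suc j) * (W * P)
          ≈⟨ +-cong (u-eq (suc i) j) (v-eq i (suc j)) ⟨
        u (suc i) j + v i (suc j) ∎
        where
        W = weight (suc i) (suc j) x
        P = pair (suc i) x y

    -- Through `shift`, this is (x)_k (q^(-l)/x)_k / (s q^(-l))_k multiplied by (s)_l (s)_k, free of
    -- denominators.
    leftTerm : ℕ → Carrier → Carrier → Carrier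
    leftTerm l x y = poch x q k * poch (r ^ l * y) q k * shift l k

    -- With w = q^(l+1), Q = q^l and K = q^k, the coefficient 1 - w x turns (q^(-l) y)_k into K - w
    -- x times (q^(-l-1) y)_k, and 1 - x turns (qx)_k into 1 - x K times (x)_k. What remains is (1 -
    -- w x²)(K - Q s) = (K - w x)(1 - Q s x) - Q s (1 - s x)(1 - x K), true because Q s² = w.
    leftTerm-suc : ∀ l x y → x * y ≈ 1# →
      (1# - q ^ suc l * (x * x)) * leftTerm (suc l) x y
      ≈ (1# - q ^ suc l * x) * (1# - q ^ l * (s * x)) * leftTerm l x y
        + - s * q ^ l * ((1# - x) * (1# - s * x)) * leftTerm l (q * x) (r * y)
    leftTerm-suc l x y xy≈1 = begin
      (1# - w * (x * x)) * (X * U * (E * (K - Q * s)))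
        ≈⟨ modulo (s * Q * (1# - s * x) * U * E) shift-x
          (modulo (w * x * (1# - Q * (s * x)) * X * E) shift-y
          (modulo ((1# - Q * (s * x)) * X * E * (U′ - U * K)) wxa≈1
          (modulo (- (X * U * E * (x - x * x * K))) Qss≈w
          (solve 11 (λ w Q s K x a E X X′ U U′ →
            (:1 :- w :* (x :* x)) :* (X :* U :* (E :* (K :- Q :* s)))
            := (:1 :- w :* x) :* (:1 :- Q :* (s :* x)) :* (X :* U′ :* E) :+ (:- s) :* Q :* ((:1 :- x) :* (:1 :- s :* x)) :* (X′ :* U :* E)
              :+ s :* Q :* (:1 :- s :* x) :* U :* E :* ((:1 :- x) :* X′ :- X :* (:1 :- x :* K))
              :+ w :* x :* (:1 :- Q :* (s :* x)) :* X :* E :* ((:1 :- a) :* U′ :- U :* (:1 :- a :* K))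
              :+ (:1 :- Q :* (s :* x)) :* X :* E :* (U′ :- U :* K) :* (w :* x :* a :- :1)
              :+ (:- (X :* U :* E :* (x :- x :* x :* K))) :* (Q :* s :* s :- w))
            refl w Q s K x a E X X′ U U′)))) ⟩
      (1# - w * x) * (1# - Q * (s * x)) * (X * U′ * E) + - s * Q * ((1# - x) * (1# - s * x)) * (X′ * U * E)
        ≈⟨ +-congˡ (*-congˡ (*-congʳ (*-congˡ (poch-cong q k (solve 3 (λ r R y → r :* R :* y := R :* (r :* y)) refl r (r ^ l) y))))) ⟩
      (1# - w * x) * (1# - Q * (s * x)) * leftTerm l x y + - s * Q * ((1# - x) * (1# - s * x)) * leftTerm l (q * x) (r * y) ∎
      where
      w = q ^ suc l
      Q = q ^ l
      K = q ^ k
      a = r ^ suc l * y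
      E = shift l k
      X = poch x q k
      X′ = poch (q * x) q k
      U = poch (r ^ suc l * y) q k
      U′ = poch (r ^ l * y) q k
      shift-x : (1# - x) * X′ ≈ X * (1# - x * K)
      shift-x = sym (trans (poch-head x q k) (*-congˡ (poch-cong q k (*-comm x q))))
      shift-y : (1# - a) * U′ ≈ U * (1# - a * K)
      shift-y = sym (trans (poch-head a q k) (*-congˡ (poch-cong q k (modulo (r ^ l * y) qr≈1
        (solve 4 (λ q r R y → r :* R :* y :* q := R :* y :+ R :* y :* (q :* r :- :1)) refl q r (r ^ l) y)))))
      wxa≈1 : w * x * a ≈ 1#
      wxa≈1 = modulo 1# xy≈1 (modulo (x * y) (^-inverse (suc l) qr≈1)
        (solve 4 (λ w x R y → w :* x :* (R :* y) := :1 :+ :1 :* (x :* y :- :1) :+ x :* y :* (w :* R :- :1)) refl w x (r ^ suc l) y))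
      Qss≈w : Q * s * s ≈ w
      Qss≈w = trans (*-assoc Q s s) (trans (*-congˡ ss≈q) (*-comm Q q))

    -- The induction on l is for all x at once, as its step also uses qx. The symbol (q x²)_(2l)
    -- suits this, since (q x²)_(2l) and (q³ x²)_(2l) both divide (q x²)_(2l+2). Its being nonzero
    -- allows the factor 1 - q^(l+1) x² of the two recurrences to be cancelled.
    connection : ∀ l x y → x * y ≈ 1# → ¬ (poch (q * (x * x)) q (double l) ≈ 0#) →
      leftTerm l x y * ((1# + x) * poch (q * (x * x)) q (double l)) ≈ poch (q * x) q l * poch (s * x) q l * rightSum l x y
    connection zero x y xy≈1 _ = trans
      (solve 3 (λ x a b → a :* b :* :1 :* ((:1 :+ x) :* :1) := :1 :* :1 :* (:1 :* :1 :* ((:1 :+ x :* :1) :* :1 :* :1) :* (a :* b) :+ con (+ 0)))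
        refl x (poch x q k) (poch (1# * y) q k))
      (*-congˡ (+-congʳ (*-congˡ (*-congʳ (poch-cong q k (sym (*-identityˡ x)))))))
    connection (suc l) x y xy≈1 D₂≉0 = *-cancelˡ γ γ≉0 (begin
      γ * (leftTerm (suc l) x y * ((1# + x) * D₂))
        ≈⟨ *-assoc _ _ _ ⟨
      γ * leftTerm (suc l) x y * ((1# + x) * D₂)
        ≈⟨ *-congʳ (leftTerm-suc l x y xy≈1) ⟩
      ((1# - w * x) * (1# - Q * (s * x)) * L + - s * Q * ((1# - x) * (1# - s * x)) * L′) * ((1# + x) * D₂)
        -- `D₂` is read in two ways: as `D` with two factors added at the end for `L`, and as `D′`
        -- with two added in front for `L′`.
        ≈⟨ modulo (- s * Q * ((1# - x) * (1# - s * x)) * L′ * (1# + x)) D₂≈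
           (solve 11 (λ q s x Q w L L′ D D′ e₁ e₂ →
             ((:1 :- w :* x) :* (:1 :- Q :* (s :* x)) :* L :+ (:- s) :* Q :* ((:1 :- x) :* (:1 :- s :* x)) :* L′) :* ((:1 :+ x) :* (D :* e₁ :* e₂))
             := (:1 :- w :* x) :* (:1 :- Q :* (s :* x)) :* e₁ :* e₂ :* (L :* ((:1 :+ x) :* D))
               :+ (:- s) :* Q :* ((:1 :- x :* x) :* (:1 :- q :* (x :* x))) :* (:1 :- s :* x) :* (:1 :- q :* x) :* (L′ :* ((:1 :+ q :* x) :* D′))
               :+ (:- s) :* Q :* ((:1 :- x) :* (:1 :- s :* x)) :* L′ :* (:1 :+ x) :* (D :* e₁ :* e₂ :- (:1 :- q :* (x :* x)) :* ((:1 :- q :* x :* (q :* x)) :* D′)))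
             refl q s x Q w L L′ D D′ (1# - q * z * q ^ double l) (1# - q * z * q ^ suc (double l))) ⟩
      (1# - w * x) * (1# - Q * (s * x)) * (1# - q * z * q ^ double l) * (1# - q * z * q ^ suc (double l)) * (L * ((1# + x) * D))
        + - s * Q * ((1# - z) * (1# - q * z)) * (1# - s * x) * (1# - q * x) * (L′ * ((1# + q * x) * D′))
        ≈⟨ +-cong (*-congˡ (connection l x y xy≈1 D≉0)) (*-congˡ (connection l (q * x) (r * y) qxry≈1 D′≉0)) ⟩
      (1# - w * x) * (1# - Q * (s * x)) * (1# - q * z * q ^ double l) * (1# - q * z * q ^ suc (double l)) * (A * B * rightSum l x y)
        + - s * Q * ((1# - z) * (1# - q * z)) * (1# - s * x) * (1# - q * x) * (A′ * B′ * rightSum l (q * x) (r * y))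
        ≈⟨ +-cong (solve 10 (λ q s x Q A B S z e₁ e₂ →
               (:1 :- q :* Q :* x) :* (:1 :- Q :* (s :* x)) :* (:1 :- q :* z :* e₁) :* (:1 :- q :* z :* e₂) :* (A :* B :* S)
               := A :* (:1 :- q :* x :* Q) :* (B :* (:1 :- s :* x :* Q)) :* ((:1 :- q :* e₁ :* z) :* (:1 :- q :* e₂ :* z) :* S))
               refl q s x Q A B (rightSum l x y) z (q ^ double l) (q ^ suc (double l)))
             (solve 8 (λ q s x Q A′ B′ S′ e →
               (:- s) :* Q :* e :* (:1 :- s :* x) :* (:1 :- q :* x) :* (A′ :* B′ :* S′)
               := (:1 :- q :* x) :* A′ :* ((:1 :- s :* x) :* B′) :* ((:- s) :* Q :* e :* S′)) refl q s x Q A′ B′ (rightSum l (q * x) (r * y)) ((1# - z) * (1# - q * z))) ⟩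
      A₂ * B₂ * ((1# - q ^ suc (double l) * z) * (1# - q ^ suc (suc (double l)) * z) * rightSum l x y)
        + (1# - q * x) * A′ * ((1# - s * x) * B′) * (- s * Q * ((1# - z) * (1# - q * z)) * rightSum l (q * x) (r * y))
        ≈⟨ +-congˡ (*-congʳ (*-cong (sym (head q)) (sym (head s)))) ⟩
      A₂ * B₂ * ((1# - q ^ suc (double l) * z) * (1# - q ^ suc (suc (double l)) * z) * rightSum l x y)
        + A₂ * B₂ * (- s * Q * ((1# - z) * (1# - q * z)) * rightSum l (q * x) (r * y))
        ≈⟨ distribˡ _ _ _ ⟨
      A₂ * B₂ * ((1# - q ^ suc (double l) * z) * (1# - q ^ suc (suc (double l)) * z) * rightSum l x y
        + - s * Q * ((1# - z) * (1# - q * z)) * rightSum l (q * x) (r * y))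
        ≈⟨ *-congˡ (rightSum-suc l x y) ⟨
      A₂ * B₂ * (γ * rightSum (suc l) x y)
        ≈⟨ solve 3 (λ u a v → u :* (a :* v) := a :* (u :* v)) refl _ _ _ ⟩
      γ * (A₂ * B₂ * rightSum (suc l) x y) ∎)
      where
      z = x * x
      w = q ^ suc l
      Q = q ^ l
      γ = 1# - w * z
      L = leftTerm l x y
      L′ = leftTerm l (q * x) (r * y)
      D = poch (q * z) q (double l)
      D₂ = poch (q * z) q (double (suc l))
      D′ = poch (q * (q * x * (q * x))) q (double l)
      A = poch (q * x) q l
      B = poch (s * x) q l
      A₂ = poch (q * x) q (suc l)
      B₂ = poch (s * x) q (suc l)
      A′ = poch (q * (q * x)) q l
      B′ = poch (s * (q * x)) q l
      D₂≈ : D₂ ≈ (1# - q * z) * ((1# - q * x * (q * x)) * D′)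
      D₂≈ = trans (poch-head (q * z) q (suc (double l))) (*-congˡ (trans (poch-head (q * z * q) q (double l)) (*-cong
        (solve 2 (λ q x → :1 :- q :* (x :* x) :* q := :1 :- q :* x :* (q :* x)) refl q x)
        (poch-cong q (double l) (solve 2 (λ q x → q :* (x :* x) :* q :* q := q :* (q :* x :* (q :* x))) refl q x)))))
      head : ∀ b → poch (b * x) q (suc l) ≈ (1# - b * x) * poch (b * (q * x)) q l
      head b = trans (poch-head (b * x) q l) (*-congˡ (poch-cong q l (solve 3 (λ b q x → b :* x :* q := b :* (q :* x)) refl b q x)))
      qxry≈1 : q * x * (r * y) ≈ 1#
      qxry≈1 = modulo 1# xy≈1 (modulo (x * y) qr≈1
        (solve 4 (λ q r x y → q :* x :* (r :* y) := :1 :+ :1 :* (x :* y :- :1) :+ x :* y :* (q :* r :- :1)) refl q r x y))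
      D≉0 : ¬ (D ≈ 0#)
      D≉0 = nonzero-*ˡ (nonzero-*ˡ D₂≉0)
      D′≉0 : ¬ (D′ ≈ 0#)
      D′≉0 D′≈0 = D₂≉0 (trans D₂≈ (trans (*-congˡ (trans (*-congˡ D′≈0) (zeroʳ _))) (zeroʳ _)))
      γ≉0 : ¬ (γ ≈ 0#)
      γ≉0 γ≈0 with poch-factor (q * z) q l (suc l)
      -- `γ` is the factor of index l, counted from 0, among the 2l + 2 factors of `D₂`.
      ... | d , eq = D₂≉0 (trans (reflexive (≡.cong (poch (q * z) q) (double-suc l)))
        (trans eq (trans (*-congˡ (trans (solve 3 (λ q z Q → :1 :- q :* z :* Q := :1 :- q :* Q :* z) refl q z Q) γ≈0)) (zeroʳ d))))
        where
        double-suc : ∀ l → double (suc l) ≡ suc (l N.+ suc l)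
        double-suc zero = ≡.refl
        double-suc (suc l) = ≡.cong (λ e → suc (suc e)) (≡.trans (double-suc l) (≡.sym (N.+-suc l (suc l))))

-- Half-integral powers of q.

module HalfPowers {c ℓ} (F : Field c ℓ) (s : Field.Carrier F) (s≠0 : ¬ (Field._≈_ F s (Field.0# F))) where
  open Field F hiding (zero)
  open FieldLemmas F
  open import Relation.Binary.Reasoning.Setoid setoid

  s⁻¹ q r : Carrier
  s⁻¹ = inv s s≠0
  q = s ^ 2
  r = s⁻¹ ^ 2

  qr≈1 : q * r ≈ 1#
  qr≈1 = ^-inverse 2 (inverseʳ s s≠0)

  ss≈q : s * s ≈ q
  ss≈q = *-congˡ (sym (*-identityʳ s))

  hpow-neg : ∀ m → hpow s s≠0 (Z.- (+ m)) ≈ s⁻¹ ^ m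
  hpow-neg zero    = refl
  hpow-neg (suc m) = refl

  hpow-⊖ : ∀ m n → hpow s s≠0 (m Z.⊖ n) ≈ s ^ m * s⁻¹ ^ n
  hpow-⊖ m zero = sym (*-identityʳ _)
  hpow-⊖ zero (suc n) = sym (*-identityˡ _)
  hpow-⊖ (suc m) (suc n) = begin
    hpow s s≠0 (suc m Z.⊖ suc n)          ≡⟨ ≡.cong (hpow s s≠0) (Z.[1+m]⊖[1+n]≡m⊖n m n) ⟩
    hpow s s≠0 (m Z.⊖ n)                  ≈⟨ hpow-⊖ m n ⟩
    s ^ m * s⁻¹ ^ n
      ≈⟨ modulo (- (s ^ m * s⁻¹ ^ n)) (inverseʳ s s≠0) (solve 4 (λ s t a b →
           a :* b := s :* a :* (t :* b) :+ (:- (a :* b)) :* (s :* t :- :1)) refl s s⁻¹ (s ^ m) (s⁻¹ ^ n)) ⟩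
    s ^ suc m * s⁻¹ ^ suc n               ∎

  s⁻¹^even : ∀ m → s⁻¹ ^ (2 N.* m) ≈ r ^ m
  s⁻¹^even m = trans (reflexive (≡.cong (s⁻¹ ^_) (N.*-comm 2 m))) (sym (^-assoc s⁻¹ 2 m))

  hpow-neg-even : ∀ m → hpow s s≠0 (Z.- (+ (2 N.* m))) ≈ r ^ m
  hpow-neg-even m = trans (hpow-neg (2 N.* m)) (s⁻¹^even m)

  hpow-neg-sextuple : ∀ m → hpow s s≠0 (Z.- (+ (6 N.* m))) ≈ r ^ triple m
  hpow-neg-sextuple m = begin
    hpow s s≠0 (Z.- (+ (6 N.* m)))   ≈⟨ hpow-neg (6 N.* m) ⟩
    s⁻¹ ^ (6 N.* m)                  ≡⟨ ≡.cong (s⁻¹ ^_) (≡.trans (N.*-assoc 2 3 m) (≡.cong (2 N.*_) (N.*-comm 3 m))) ⟩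
    s⁻¹ ^ (2 N.* (m N.* 3))          ≈⟨ s⁻¹^even (m N.* 3) ⟩
    r ^ (m N.* 3)                    ≈⟨ ^-assoc r 3 m ⟨
    (r ^ 3) ^ m                      ≈⟨ QLemmas.^-triple F r m ⟨
    r ^ triple m                     ∎

  hpow-diff : ∀ m n → hpow s s≠0 (+ m Z.- + (2 N.* n)) ≈ s ^ m * r ^ n
  hpow-diff m n = trans (reflexive (≡.cong (hpow s s≠0) (Z.m-n≡m⊖n m (2 N.* n))))
    (trans (hpow-⊖ m (2 N.* n)) (*-congˡ (s⁻¹^even n)))

-- Clearing denominators and exchanging the two sums.

theorem11 : ∀ {c ℓ'} (F : Field c ℓ') → CharZero F →
  let open Field F in
  (s : Carrier) (s≠0 : ¬ (s ≈ 0#)) →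
  let q  = s ^ 2
      q3 = q ^ 3
      qz = hpow s s≠0
  in
  (l n : ℕ) (x : Carrier) (x≠0 : ¬ (x ≈ 0#)) →
  let a1 = qz (Z.- (+ (6 N.* n)))
      a2 = div (qz (Z.- (+ (2 N.* l)))) x x≠0
      a3 = qz (+ 1 Z.- + (2 N.* l))
      DL = λ (k : ℕ) → poch q q k * poch (- 1#) q k * poch a3 q k
                        * poch (- s) q k * poch a1 q k
      DP = poch (q * x * x) q l * poch s q l
      DR = λ (i : ℕ) → (1# + 1#) * (1# + x) * poch q q i
                        * poch (x * x * q ^ (l N.+ 1)) q i
      DB = poch q q3 n * poch (q * q) q3 n
  in
  (hL : (k : Fin (N.suc n)) → ¬ (DL (toℕ k) ≈ 0#)) →
  (hP : ¬ (DP ≈ 0#)) →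
  (hR : (i : Fin (N.suc l)) → ¬ (DR (toℕ i) ≈ 0#)) →
  (hB : ¬ (DB ≈ 0#)) →
  sumFin (N.suc n) (λ k →
      div (poch a1 q3 (toℕ k) * poch x q (toℕ k) * poch a2 q (toℕ k) * q ^ toℕ k)
          (DL (toℕ k)) (hL k))
  ≈
  div (poch (q * x) q l * poch (s * x) q l) DP hP
  * sumFin (N.suc l) (λ i →
      s ^ ((2 N.* l N.+ 1) N.* toℕ i)
      * div ((1# + x * q ^ toℕ i) * poch (qz (Z.- (+ (2 N.* l)))) q (toℕ i)
             * poch (x * x) q (toℕ i))
            (DR (toℕ i)) (hR i)
      * (div (poch (q ^ (1 N.+ toℕ i) * x) q3 n
              * poch (div (qz (+ 4 Z.- + (2 N.* toℕ i))) x x≠0) q3 n) DB hB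
         + div (poch (q ^ (2 N.+ toℕ i) * x) q3 n
              * poch (div (qz (+ 2 Z.- + (2 N.* toℕ i))) x x≠0) q3 n) DB hB))
theorem11 F _ s s≠0 l n x x≠0 hL hP hR hB = *-cancelˡ scale scale≉0 (begin
  scale * sumFin (suc n) (λ k → lhs k)
    ≈⟨ *-distribˡ-sumFin (suc n) scale lhs ⟩
  sumFin (suc n) (λ k → scale * lhs k)
    ≈⟨ sumFin-cong (suc n) lhs-term ⟩
  anti n (λ k m → coeff k m * (1# + q ^ k) * (PQ * rightSum k l x y))
    ≈⟨ sumFin-cong (suc n) expand ⟩
  sumFin (suc n) (λ k → sumFin (suc l) (λ i → PQ * cell i k))
    ≈⟨ sumFin-swap (suc l) (suc n) (λ i k → PQ * cell i k) ⟨
  sumFin (suc l) (λ i → sumFin (suc n) (λ k → PQ * cell i k))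
    ≈⟨ sumFin-cong (suc l) (λ i → *-distribˡ-sumFin (suc n) PQ (cell i)) ⟨
  sumFin (suc l) (λ i → PQ * sumFin (suc n) (cell i))
    ≈⟨ *-distribˡ-sumFin (suc l) PQ (λ i → sumFin (suc n) (cell i)) ⟨
  PQ * sumFin (suc l) (λ i → sumFin (suc n) (cell i))
    ≈⟨ *-congˡ (sumFin-cong (suc l) rhs-term) ⟨
  PQ * sumFin (suc l) (λ i → M * rhs i)
    ≈⟨ *-congˡ (*-distribˡ-sumFin (suc l) M rhs) ⟨
  PQ * (M * sumFin (suc l) rhs)
    ≈⟨ *-assoc _ _ _ ⟨
  PQ * M * sumFin (suc l) rhs
    ≈⟨ *-congʳ prefactor ⟨
  scale * div PQ DP hP * sumFin (suc l) rhs
    ≈⟨ *-assoc _ _ _ ⟩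
  scale * (div PQ DP hP * sumFin (suc l) rhs) ∎)
  where
  open Field F hiding (zero)
  open FieldLemmas F
  open HalfPowers F s s≠0
  open QLemmas F q
  open CubicSum F q
  open Connection F q r s qr≈1 ss≈q
  open import Relation.Binary.Reasoning.Setoid setoid

  qz = hpow s s≠0
  y = inv x x≠0
  xy≈1 = inverseʳ x x≠0
  z = x * x
  a1 = qz (Z.- (+ (6 N.* n)))
  a2 = div (qz (Z.- (+ (2 N.* l)))) x x≠0
  a3 = qz (+ 1 Z.- + (2 N.* l))
  DL DR : ℕ → Carrier
  DL k = poch q q k * poch (- 1#) q k * poch a3 q k * poch (- s) q k * poch a1 q k
  DR i = (1# + 1#) * (1# + x) * poch q q i * poch (x * x * q ^ (l N.+ 1)) q i
  DP = poch (q * x * x) q l * poch s q l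
  PQ = poch (q * x) q l * poch (s * x) q l

  lhs : Fin (suc n) → Carrier
  lhs k = div (poch a1 q3 (toℕ k) * poch x q (toℕ k) * poch a2 q (toℕ k) * q ^ toℕ k) (DL (toℕ k)) (hL k)

  first second bracket : ℕ → Carrier
  first i = poch (q ^ (1 N.+ i) * x) q3 n * poch (div (qz (+ 4 Z.- + (2 N.* i))) x x≠0) q3 n
  second i = poch (q ^ (2 N.+ i) * x) q3 n * poch (div (qz (+ 2 Z.- + (2 N.* i))) x x≠0) q3 n
  bracket i = div (first i) (base n) hB + div (second i) (base n) hB

  numerator : ℕ → Carrier
  numerator i = (1# + x * q ^ i) * poch (qz (Z.- (+ (2 N.* l)))) q i * poch (x * x) q i

  rhs : Fin (suc l) → Carrier
  rhs i = s ^ ((2 N.* l N.+ 1) N.* toℕ i) * div (numerator (toℕ i)) (DR (toℕ i)) (hR i) * bracket (toℕ i)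

  cell : Fin (suc l) → Fin (suc n) → Carrier
  cell i k = signedGauss (toℕ i) (l N.∸ toℕ i) * weight (toℕ i) (l N.∸ toℕ i) x
    * (coeff (toℕ k) (n N.∸ toℕ k) * (1# + q ^ toℕ k) * pair (toℕ k) (toℕ i) x y)

  H = poch (x * x * q ^ (l N.+ 1)) q l
  D = poch (q * z) q (double l)
  M = (1# + 1#) * (1# + x) * H * base n
  -- The factors are those required by `coeff-poch`, `shift-poch` and `connection` on the left. On
  -- the right `D` is (q x²)_l times `H`, so `DP` cancels and `M` is left for the inner terms.
  scale = (1# + 1#) * base n * poch s q l * ((1# + x) * D)

  a1≈ : ∀ p k → poch a1 p k ≈ poch (r ^ triple n) p k
  a1≈ p k = poch-cong p k (hpow-neg-sextuple n)
  a2≈ : ∀ k → poch a2 q k ≈ poch (r ^ l * y) q k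
  a2≈ k = poch-cong q k (*-congʳ (hpow-neg-even l))
  a3≈ : ∀ k → poch a3 q k ≈ poch (s * r ^ l) q k
  a3≈ k = poch-cong q k (trans (hpow-diff 1 l) (*-congʳ (*-identityʳ s)))

  double≡ : ∀ m → double m ≡ m N.+ m
  double≡ zero = ≡.refl
  double≡ (suc m) = ≡.cong suc (≡.trans (≡.cong suc (double≡ m)) (≡.sym (N.+-suc m m)))

  D≈ : D ≈ poch (q * x * x) q l * H
  D≈ = trans (reflexive (≡.cong (poch (q * z) q) (double≡ l))) (trans (poch-+ (q * z) q l l)
    (*-cong (poch-cong q l (sym (*-assoc q x x))) (poch-cong q l (trans
      (solve 3 (λ q z Q → q :* z :* Q := z :* (Q :* (q :* :1))) refl q z (q ^ l)) (*-congˡ (sym (^-homo-+ q l 1)))))))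

  -- The extreme indices of `hR` are the useful ones: at i = 0 both symbols in `DR` are 1, and at i
  -- = l the last one is `H`.
  DR₀≉0 : ¬ ((1# + 1#) * (1# + x) ≈ 0#)
  DR₀≉0 = nonzero-*ˡ (nonzero-*ˡ (hR Fin.zero))
  H≉0 : ¬ (H ≈ 0#)
  H≉0 = ≡.subst (λ e → ¬ (poch (x * x * q ^ (l N.+ 1)) q e ≈ 0#)) (Fin.toℕ-fromℕ l) (nonzero-*ʳ (hR (Data.Fin.fromℕ l)))
  D≉0 : ¬ (D ≈ 0#)
  D≉0 D≈0 = *-nonzero (nonzero-*ˡ hP) H≉0 (trans (sym D≈) D≈0)
  scale≉0 : ¬ (scale ≈ 0#)
  scale≉0 = *-nonzero (*-nonzero (*-nonzero (nonzero-*ˡ DR₀≉0) hB) (nonzero-*ʳ hP)) (*-nonzero (nonzero-*ʳ DR₀≉0) D≉0)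

  prefactor : scale * div PQ DP hP ≈ PQ * M
  prefactor = div-intro scale PQ DP hP (PQ * M) (trans
    (*-congʳ (*-congˡ (*-congˡ D≈)))
    (solve 7 (λ t b e x d H P → t :* b :* e :* ((:1 :+ x) :* (d :* H)) :* P := d :* e :* (P :* (t :* (:1 :+ x) :* H :* b)))
      refl (1# + 1#) (base n) (poch s q l) x (poch (q * x * x) q l) H PQ))

  lhs-numerator : ∀ k m → k N.+ m ≡ n →
    scale * (poch a1 q3 k * poch x q k * poch a2 q k * q ^ k) ≈ DL k * (coeff k m * (1# + q ^ k) * (PQ * rightSum k l x y))
  lhs-numerator k m ≡.refl = begin
    scale * (poch a1 q3 k * X * poch a2 q k * q ^ k)
      ≈⟨ *-congˡ (*-congʳ (*-cong (*-congʳ (a1≈ q3 k)) (a2≈ k))) ⟩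
    scale * (V * X * Y * q ^ k)
      ≈⟨ solve 9 (λ t b e x D V X Y B → t :* b :* e :* ((:1 :+ x) :* D) :* (V :* X :* Y :* B)
           := t :* b :* (V :* B) :* (e :* X :* Y :* ((:1 :+ x) :* D))) refl (1# + 1#) (base n) (poch s q l) x D V X Y (q ^ k) ⟩
    (1# + 1#) * base n * (V * q ^ k) * (poch s q l * X * Y * ((1# + x) * D))
      ≈⟨ *-congʳ (coeff-poch r qr≈1 s ss≈q k m) ⟨
    g * (e₁ * e₂ * poch s q k * e₄ * e₅) * (poch s q l * X * Y * ((1# + x) * D))
      ≈⟨ solve 10 (λ g e₁ e₂ σ e₄ e₅ τ X Y u → g :* (e₁ :* e₂ :* σ :* e₄ :* e₅) :* (τ :* X :* Y :* u)
           := e₁ :* e₂ :* e₄ :* e₅ :* g :* X :* Y :* u :* (τ :* σ)) refl g e₁ e₂ (poch s q k) e₄ e₅ (poch s q l) X Y ((1# + x) * D) ⟩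
    e₁ * e₂ * e₄ * e₅ * g * X * Y * ((1# + x) * D) * (poch s q l * poch s q k)
      -- `coeff-poch` has supplied (s)_k, but `DL` contains (s q^(-l))_k. Together with the (s)_l of
      -- `scale`, (s)_k is traded for `shift l k` times that symbol, without dividing by (s)_k,
      -- which may vanish.
      ≈⟨ *-congˡ (shift-poch l k) ⟨
    e₁ * e₂ * e₄ * e₅ * g * X * Y * ((1# + x) * D) * (shift l k * e₃)
      ≈⟨ solve 10 (λ g e₁ e₂ e₃ e₄ e₅ E X Y u → e₁ :* e₂ :* e₄ :* e₅ :* g :* X :* Y :* u :* (E :* e₃)
           := e₁ :* e₂ :* e₃ :* e₄ :* e₅ :* (g :* (X :* Y :* E :* u))) refl g e₁ e₂ e₃ e₄ e₅ (shift l k) X Y ((1# + x) * D) ⟩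
    e₁ * e₂ * e₃ * e₄ * e₅ * (g * (leftTerm k l x y * ((1# + x) * D)))
      ≈⟨ *-cong (*-cong (*-congʳ (*-congˡ (sym (a3≈ k)))) (sym (a1≈ q k))) (*-congˡ (connection k l x y xy≈1 D≉0)) ⟩
    DL k * (g * (PQ * rightSum k l x y)) ∎
    where
    X = poch x q k
    Y = poch (r ^ l * y) q k
    V = poch (r ^ triple n) q3 k
    g = coeff k m * (1# + q ^ k)
    e₁ = poch q q k
    e₂ = poch (- 1#) q k
    e₃ = poch (s * r ^ l) q k
    e₄ = poch (- s) q k
    e₅ = poch (r ^ triple n) q k

  lhs-term : ∀ k → scale * lhs k ≈ coeff (toℕ k) (n N.∸ toℕ k) * (1# + q ^ toℕ k) * (PQ * rightSum (toℕ k) l x y)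
  lhs-term k = div-intro scale _ (DL (toℕ k)) (hL k) _ (lhs-numerator (toℕ k) (n N.∸ toℕ k) (complement n k))

  expand : ∀ k → coeff (toℕ k) (n N.∸ toℕ k) * (1# + q ^ toℕ k) * (PQ * rightSum (toℕ k) l x y)
    ≈ sumFin (suc l) (λ i → PQ * cell i k)
  expand k = begin
    g * (PQ * rightSum (toℕ k) l x y)            ≈⟨ *-assoc _ _ _ ⟨
    g * PQ * rightSum (toℕ k) l x y              ≈⟨ *-distribˡ-sumFin (suc l) (g * PQ) (λ i → term (toℕ k) (toℕ i) (l N.∸ toℕ i) x y) ⟩
    sumFin (suc l) (λ i → g * PQ * term (toℕ k) (toℕ i) (l N.∸ toℕ i) x y)
      ≈⟨ sumFin-cong (suc l) (λ i → solve 4 (λ g P a b → g :* P :* (a :* b) := P :* (a :* (g :* b))) refl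
           g PQ (signedGauss (toℕ i) (l N.∸ toℕ i) * weight (toℕ i) (l N.∸ toℕ i) x) (pair (toℕ k) (toℕ i) x y)) ⟩
    sumFin (suc l) (λ i → PQ * cell i k)         ∎
    where g = coeff (toℕ k) (n N.∸ toℕ k) * (1# + q ^ toℕ k)

  -- `H` is cut after i factors: the front is the last symbol of `DR`, the tail is the last symbol
  -- of `weight`, and the power of s is absorbed by `signedGauss`.
  rhs-numerator : ∀ i j → i N.+ j ≡ l →
    (1# + 1#) * (1# + x) * H * s ^ ((2 N.* l N.+ 1) N.* i) * numerator i ≈ DR i * (signedGauss i j * weight i j x)
  rhs-numerator i j ≡.refl = begin
    t * H * s ^ ((2 N.* l N.+ 1) N.* i) * (u * poch (qz (Z.- (+ (2 N.* l)))) q i * v)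
      ≈⟨ *-cong (*-cong (*-congˡ H≈) (reflexive (≡.cong (λ e → s ^ (e N.* i)) exponent)))
                (*-congʳ (*-congˡ (poch-cong q i (hpow-neg-even l)))) ⟩
    t * (H₁ * H₂) * s ^ (suc (double l) N.* i) * (u * poch (r ^ l) q i * v)
      ≈⟨ solve 7 (λ t a b S u p v → t :* (a :* b) :* S :* (u :* p :* v) := t :* a :* b :* u :* v :* (S :* p)) refl
           t H₁ H₂ (s ^ (suc (double l) N.* i)) u (poch (r ^ l) q i) v ⟩
    t * H₁ * H₂ * u * v * (s ^ (suc (double l) N.* i) * poch (r ^ l) q i)
      ≈⟨ *-congˡ (signedGauss-poch i j) ⟩
    t * H₁ * H₂ * u * v * (signedGauss i j * poch q q i)
      ≈⟨ solve 7 (λ t a b u v σ p → t :* a :* b :* u :* v :* (σ :* p) := t :* p :* a :* (σ :* (u :* v :* b))) refl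
           t H₁ H₂ u v (signedGauss i j) (poch q q i) ⟩
    DR i * (signedGauss i j * weight i j x) ∎
    where
    t = (1# + 1#) * (1# + x)
    u = 1# + x * q ^ i
    v = poch (x * x) q i
    H₁ = poch (x * x * q ^ (l N.+ 1)) q i
    H₂ = poch (q ^ suc (double i N.+ j) * z) q j
    H≈ : H ≈ H₁ * H₂
    H≈ = trans (poch-+ (x * x * q ^ (l N.+ 1)) q i j) (*-congˡ (poch-cong q j (begin
      z * q ^ (l N.+ 1) * q ^ i                ≈⟨ *-congʳ (*-congˡ (^-homo-+ q l 1)) ⟩
      z * (q ^ l * (q * 1#)) * q ^ i           ≈⟨ *-congʳ (*-congˡ (*-congʳ (^-homo-+ q i j))) ⟩
      z * (q ^ i * q ^ j * (q * 1#)) * q ^ i   ≈⟨ solve 4 (λ z A B q → z :* (A :* B :* (q :* :1)) :* A := q :* (A :* A :* B) :* z) refl z (q ^ i) (q ^ j) q ⟩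
      q * (q ^ i * q ^ i * q ^ j) * z          ≈⟨ *-congʳ (*-congˡ (*-congʳ (^-double i))) ⟨
      q * (q ^ double i * q ^ j) * z           ≈⟨ *-congʳ (*-congˡ (^-homo-+ q (double i) j)) ⟨
      q ^ suc (double i N.+ j) * z             ∎)))
    exponent : 2 N.* l N.+ 1 ≡ suc (double l)
    exponent = ≡.trans (N.+-comm (2 N.* l) 1) (≡.cong suc (≡.trans (≡.cong (l N.+_) (N.+-identityʳ l)) (≡.sym (double≡ l))))

  -- This is `cubic-sum` at q^i x, whose inverse is q^(-i) y: the arguments q^(2-i)/x and q^(1-i)/x
  -- are q² and q times that inverse.
  bracket≈ : ∀ i → base n * bracket i
    ≈ anti n (λ k m → coeff k m * (1# + q ^ k) * pair k i x y)
  bracket≈ i = begin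
    base n * (div (first i) (base n) hB + div (second i) (base n) hB)
      ≈⟨ solve 3 (λ b u v → b :* (u :+ v) := u :* b :+ v :* b) refl (base n) (div (first i) (base n) hB) (div (second i) (base n) hB) ⟩
    div (first i) (base n) hB * base n + div (second i) (base n) hB * base n
      ≈⟨ +-cong (div-* (first i) (base n) hB) (div-* (second i) (base n) hB) ⟩
    first i + second i
      ≈⟨ +-cong (*-cong (poch-cong q3 n (*-assoc q (q ^ i) x)) (poch-cong q3 n (trans (*-congʳ (hpow-diff 4 i)) (trans (*-congʳ (*-congʳ q²)) (*-assoc _ _ _)))))
                (*-cong (poch-cong q3 n (solve 3 (λ q A x → q :* (q :* A) :* x := q :* q :* (A :* x)) refl q (q ^ i) x))
                        (poch-cong q3 n (trans (*-congʳ (hpow-diff 2 i)) (*-assoc q (r ^ i) y)))) ⟩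
    poch (q * (q ^ i * x)) q3 n * poch (q * q * (r ^ i * y)) q3 n + poch (q * q * (q ^ i * x)) q3 n * poch (q * (r ^ i * y)) q3 n
      ≈⟨ cubic-sum n (q ^ i * x) (r ^ i * y) inverse ⟩
    anti n (λ k m → coeff k m * (1# + q ^ k) * pair k i x y) ∎
    where
    q² : s ^ 4 ≈ q * q
    q² = solve 1 (λ s → s :^ 4 := s :^ 2 :* s :^ 2) refl s
    inverse : q ^ i * x * (r ^ i * y) ≈ 1#
    inverse = modulo 1# xy≈1 (modulo (x * y) (^-inverse i qr≈1)
      (solve 4 (λ A x R y → A :* x :* (R :* y) := :1 :+ :1 :* (x :* y :- :1) :+ x :* y :* (A :* R :- :1)) refl (q ^ i) x (r ^ i) y))

  rhs-term : ∀ i → M * rhs i ≈ sumFin (suc n) (cell i)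
  rhs-term i = begin
    t * H * base n * (S * div (numerator (toℕ i)) (DR (toℕ i)) (hR i) * bracket (toℕ i))
      ≈⟨ solve 6 (λ t H b S d β → t :* H :* b :* (S :* d :* β) := t :* H :* S :* d :* (b :* β)) refl
           t H (base n) S (div (numerator (toℕ i)) (DR (toℕ i)) (hR i)) (bracket (toℕ i)) ⟩
    t * H * S * div (numerator (toℕ i)) (DR (toℕ i)) (hR i) * (base n * bracket (toℕ i))
      ≈⟨ *-cong (div-intro (t * H * S) (numerator (toℕ i)) (DR (toℕ i)) (hR i) _ (rhs-numerator (toℕ i) (l N.∸ toℕ i) (complement l i)))
                (bracket≈ (toℕ i)) ⟩
    σ * anti n (λ k m → coeff k m * (1# + q ^ k) * pair k (toℕ i) x y)
      ≈⟨ *-distribˡ-sumFin (suc n) σ (λ k → coeff (toℕ k) (n N.∸ toℕ k) * (1# + q ^ toℕ k) * pair (toℕ k) (toℕ i) x y) ⟩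
    sumFin (suc n) (cell i) ∎
    where
    t = (1# + 1#) * (1# + x)
    S = s ^ ((2 N.* l N.+ 1) N.* toℕ i)
    σ = signedGauss (toℕ i) (l N.∸ toℕ i) * weight (toℕ i) (l N.∸ toℕ i) x
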